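{- Let $G$ be a connected graph (loops and multiple edges allowed) with minimum degree at least $3$, let $v$ be a vertex of $G$ with $\deg_G(v)=4$, and let $G^{*}$ be a graph obtained from $G$ by splitting $v$ into two adjacent vertices $v'$ and $v''$, where the splitting-edge $v'v''$ is not a cut-edge of the $v$-splitting subgraph $G^{*}_{spl}(v)$. Then $G$ is upper embeddable if and only if $G^{*}$ is upper embeddable.
   Context: The Betti number of a connected graph $G$ is $\beta(G)=|E(G)|-|V(G)|+1$. The maximum genus $\gamma_M(G)$ of a connected graph $G$ is the largest integer $k$ such that $G$ has a (cellular) embedding in the orientable surface of genus $k$. $G$ is upper embeddable if $\gamma_M(G)=\lfloor \beta(G)/2\rfloor$. A vertex splitting on a vertex $v$ with $\deg_G(v)\geqslant 4$ replaces $v$ by two adjacent vertices $v'$ and $v''$ (joined by a new edge $v'v''$, the splitting-edge) and replaces each edge $e=vu$ incident to $v$ either by the edge $v'u$ or by the edge $v''u$ (the choice for each edge is arbitrary). If $G^{*}$ is obtained from $G$ by such a splitting of $v$, the $v$-splitting subgraph $G^{*}_{spl}(v)$ is the subgraph of $G^{*}$ induced by $v'$, $v''$ and all vertices adjacent to $v'$ or $v''$. -}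

module Defs where

open import Data.Nat using (ℕ; zero; suc; _+_; _*_; _∸_; _≤_; ⌊_/2⌋)
open import Data.Fin using (Fin; zero; suc)
open import Data.Fin.Properties using (_≟_)
open import Data.Bool using (Bool; true; false; not; if_then_else_)
open import Data.Product using (Σ; ∃; _×_; _,_; proj₁; proj₂)
open import Data.Sum using (_⊎_)
open import Data.List using (List; map; allFin)
open import Data.Nat.ListAction using (sum)
open import Data.Unit using (⊤; tt)
open import Data.Empty using (⊥)
open import Relation.Nullary using (¬_; yes; no)
open import Relation.Binary.PropositionalEquality using (_≡_)
open import Function.Bundles using (_↔_; Inverse; _⇔_)

record Graph : Set where
  field
    V    : ℕ
    E    : ℕ
    ends : Fin E → Fin V × Fin V
open Graph public

Dart : Graph → Set
Dart G = Fin (E G) × Bool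

vert : (G : Graph) → Dart G → Fin (V G)
vert G (e , false) = proj₁ (ends G e)
vert G (e , true)  = proj₂ (ends G e)

flip : (G : Graph) → Dart G → Dart G
flip G (e , b) = e , not b

-- degree: number of darts at v (a loop contributes 2)
endsAt : (G : Graph) → Fin (V G) → Fin (E G) → ℕ
endsAt G v e = ind (vert G (e , false)) + ind (vert G (e , true))
  where
  ind : Fin (V G) → ℕ
  ind x with x ≟ v
  ... | yes _ = 1
  ... | no  _ = 0

deg : (G : Graph) → Fin (V G) → ℕ
deg G v = sum (map (endsAt G v) (allFin (E G)))

-- Betti number (cycle rank) |E| - |V| + 1 (for connected graphs |E|+1 ≥ |V|)
betti : Graph → ℕ
betti G = E G + 1 ∸ V G

Joins : (G : Graph) → Fin (E G) → Fin (V G) → Fin (V G) → Set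
Joins G e x y = (ends G e ≡ (x , y)) ⊎ (ends G e ≡ (y , x))

data Walk (G : Graph) (ok : Fin (E G) → Set) : Fin (V G) → Fin (V G) → Set where
  here : ∀ {u} → Walk G ok u u
  step : ∀ {u w x} (e : Fin (E G)) → ok e → Joins G e w x →
         Walk G ok u w → Walk G ok u x

Connected : Graph → Set
Connected G = ∀ (u w : Fin (V G)) → Walk G (λ _ → ⊤) u w

Adjacent : (G : Graph) → Fin (V G) → Fin (V G) → Set
Adjacent G x y = ∃ λ e → Joins G e x y

-- Orientable embeddings as rotation systems (Heffter–Edmonds).

iter : ∀ {A : Set} → (A → A) → ℕ → A → A
iter f zero    a = a
iter f (suc k) a = f (iter f k a)

record Rotation (G : Graph) : Set where
  field
    ρ        : Dart G ↔ Dart G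
    local    : ∀ d → vert G (Inverse.to ρ d) ≡ vert G d
    cyclic   : ∀ d d' → vert G d ≡ vert G d' →
               ∃ λ k → iter (Inverse.to ρ) k d ≡ d'
open Rotation public

facePerm : (G : Graph) → Rotation G → Dart G → Dart G
facePerm G R d = Inverse.to (ρ R) (flip G d)

HasOrbits : ∀ {A : Set} → (A → A) → ℕ → Set
HasOrbits {A} f F = Σ (A → Fin F) λ c →
    (∀ (i : Fin F) → ∃ λ a → c a ≡ i)
  × (∀ a b → (c a ≡ c b) ⇔ (∃ λ k → iter f k a ≡ b))

-- the embedding given by R lies on the orientable surface of genus g:
-- V - E + F = 2 - 2g, written additively.
EmbGenus : (G : Graph) → Rotation G → ℕ → Set
EmbGenus G R g = ∃ λ F → HasOrbits (facePerm G R) F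
                   × (V G + F + 2 * g ≡ E G + 2)

IsMaxGenus : Graph → ℕ → Set
IsMaxGenus G k = (∃ λ R → EmbGenus G R k)
               × (∀ R g → EmbGenus G R g → g ≤ k)

UpperEmbeddable : Graph → Set
UpperEmbeddable G = IsMaxGenus G ⌊ betti G /2⌋

-- Vertex splitting.
-- split G v side : new vertex set Fin (suc V); v' = suc v, v'' = zero;
-- old vertex x ↦ suc x.  Edge zero is the splitting-edge v'v'';
-- old edge e ↦ suc e, and each end of e at v is moved to v'' if
-- side e b = true, otherwise to v'.  (Ends not at v are unchanged.)

splitEnd : (V : ℕ) → Fin V → Bool → Fin V → Fin (suc V)
splitEnd V v s x with x ≟ v
... | yes _ = if s then zero else suc x
... | no  _ = suc x

split : (G : Graph) → Fin (V G) → (Fin (E G) → Bool → Bool) → Graph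
split G v side = record { V = suc (V G) ; E = suc (E G) ; ends = ends' }
  where
  ends' : Fin (suc (E G)) → Fin (suc (V G)) × Fin (suc (V G))
  ends' zero    = suc v , zero
  ends' (suc e) = splitEnd (V G) v (side e false) (proj₁ (ends G e))
                , splitEnd (V G) v (side e true)  (proj₂ (ends G e))

InSpl : (G : Graph) (v : Fin (V G)) (side : Fin (E G) → Bool → Bool) →
        Fin (suc (V G)) → Set
InSpl G v side x = (x ≡ suc v) ⊎ (x ≡ zero)
                 ⊎ Adjacent (split G v side) (suc v) x
                 ⊎ Adjacent (split G v side) zero x

-- edges of the (induced) v-splitting subgraph other than the splitting edge
SplEdgeNotSplitting : (G : Graph) (v : Fin (V G)) (side : Fin (E G) → Bool → Bool) →
                      Fin (suc (E G)) → Set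
SplEdgeNotSplitting G v side zero    = ⊥
SplEdgeNotSplitting G v side (suc e) =
    InSpl G v side (proj₁ (ends (split G v side) (suc e)))
  × InSpl G v side (proj₂ (ends (split G v side) (suc e)))

-- the splitting-edge v'v'' is not a cut-edge of G*_spl(v):
-- v' and v'' remain connected in G*_spl(v) minus the splitting-edge.
SplitEdgeNotCut : (G : Graph) (v : Fin (V G)) (side : Fin (E G) → Bool → Bool) → Set
SplitEdgeNotCut G v side =
  Walk (split G v side) (SplEdgeNotSplitting G v side) (suc v) zero

{-# OPTIONS --safe #-}

-- Composing a permutation with a transposition (x y) merges the orbits of x and y if they differ and splits
-- their common orbit otherwise.  Contracting the splitting-edge keeps the number of faces, and so does
-- inserting it when the darts of v′ are consecutive in the rotation at v.  It remains to treat a rotation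
-- (a c b d) at v in which the sides alternate.  The splitting-edge lies on a cycle of length at most 4.
-- If two edges of v on different sides are parallel, or the two ends of a loop are on different sides, the
-- automorphism exchanging them gives a rotation without alternation.  Otherwise some edge f joins the far
-- ends of two darts, say a and c, on different sides.  Moving one dart at v either creates no new face or
-- makes a, c, b lie on three different faces; in the latter case the two new faces disappear by a second
-- move at v, or by moving the far end of a or of c next to f (possibly after reversing the rotation at v):
-- each of these moves merges three faces into one.

module Submission where

open import Defs
open import Data.Nat using (ℕ; zero; suc; _+_; _*_; _∸_; _≤_; _<_; z≤n; s≤s; ⌊_/2⌋)
open import Data.Nat.Properties using (anyUpTo?; m∸n+n≡m; <⇒≤; m≤n⇒m<n∨m≡n; n<1+n; ∸-monoʳ-<; +-comm; suc-injective; m+n≤o⇒m≤o∸n; ⌊n/2⌋-mono; n≡⌊n+n/2⌋; +-cancelˡ-≤; n≤0⇒n≡0; +-identityʳ; ≤-reflexive; ≤-trans; m<n⇒0<n∸m; m∸n≤m; ≤-pred; m≤m+n)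
open import Data.Nat.ListAction using (sum)
open import Data.Nat.Solver using (module +-*-Solver)
open import Data.Fin using (Fin; zero; suc; toℕ; fromℕ<; punchIn; punchOut)
import Data.Fin.Properties as Fin
open import Data.Bool using (Bool; true; false; not)
import Data.Bool.Properties as Bool
open import Data.Maybe using (Maybe; just; nothing)
open import Data.Maybe.Properties using (just-injective)
open import Data.List using (List; []; _∷_; map; allFin; length; lookup; filter; cartesianProduct)
open import Data.List.Membership.Propositional using (_∈_)
open import Data.List.Membership.Propositional.Properties using (∈-filter⁺; ∈-filter⁻; ∈-cartesianProduct⁺; ∈-allFin; ∈-lookup)
open import Data.List.Relation.Unary.All as All using ([]; _∷_)
open import Data.List.Relation.Unary.AllPairs using ([]; _∷_)
open import Data.List.Relation.Unary.Any as Any using (here; there)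
open import Data.List.Relation.Unary.Any.Properties using (lookup-index)
open import Data.List.Relation.Unary.Unique.Propositional using (Unique)
open import Data.List.Relation.Unary.Unique.Propositional.Properties using (filter⁺; cartesianProduct⁺; allFin⁺)
open import Data.Product using (Σ; ∃; _×_; _,_; proj₁; proj₂)
open import Data.Product.Properties using (≡-dec)
open import Data.Sum using (_⊎_; inj₁; inj₂)
open import Data.Empty using (⊥; ⊥-elim)
open import Relation.Nullary using (¬_; Dec; yes; no)
open import Relation.Binary.Definitions using (DecidableEquality)
open import Relation.Binary.PropositionalEquality using (_≡_; _≢_; refl; sym; trans; cong; cong₂; subst)
open import Function.Base using (_∘_)
open import Function.Bundles using (_⇔_; mk⇔; module Equivalence; _↔_; mk↔ₛ′; Inverse)

-- Orbits of a map and colourings by orbits.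

Reach : {A : Set} → (A → A) → A → A → Set
Reach f a b = ∃ λ k → iter f k a ≡ b

module _ {A : Set} {f : A → A} where

  iter-shift : ∀ k a → iter f k (f a) ≡ f (iter f k a)
  iter-shift zero    a = refl
  iter-shift (suc k) a = cong f (iter-shift k a)

  iter-+ : ∀ j k a → iter f (j + k) a ≡ iter f j (iter f k a)
  iter-+ zero    k a = refl
  iter-+ (suc j) k a = cong f (iter-+ j k a)

  reach-refl : ∀ {a} → Reach f a a
  reach-refl = 0 , refl

  reach-step : ∀ {a} → Reach f a (f a)
  reach-step = 1 , refl

  reach-≡ : ∀ {a b} → f a ≡ b → Reach f a b
  reach-≡ p = 1 , p

  reach-trans : ∀ {a b c} → Reach f a b → Reach f b c → Reach f a c
  reach-trans {a} (j , p) (k , q) = k + j , trans (iter-+ k j a) (trans (cong (iter f k) p) q)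

-- `Reach` uses forward iterates only, so such a colouring forces every orbit to be a cycle: `f a`
-- has the colour of `a` and therefore leads back to `a`.
OrbitMap : {A C : Set} → (A → A) → (A → C) → Set
OrbitMap f c = ∀ a b → (c a ≡ c b) ⇔ Reach f a b

module _ {A C : Set} {f : A → A} {c : A → C} where

  invariant-reach : (∀ a → c (f a) ≡ c a) → ∀ {a b} → Reach f a b → c a ≡ c b
  invariant-reach inv {a} (zero  , p) = cong c p
  invariant-reach inv {a} (suc k , p) =
    trans (invariant-reach inv (k , refl)) (trans (sym (inv (iter f k a))) (cong c p))

  module _ (o : OrbitMap f c) where

    reach : ∀ {a b} → c a ≡ c b → Reach f a b
    reach = Equivalence.to (o _ _)

    sameColour : ∀ {a b} → Reach f a b → c a ≡ c b
    sameColour = Equivalence.from (o _ _)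

    invariant : ∀ a → c (f a) ≡ c a
    invariant a = sym (sameColour reach-step)

-- Composition with a transposition: merging and splitting orbits.

-- g is f followed by the transposition (x y).
record Toggled {A : Set} (x y : A) (f g : A → A) : Set where
  field
    x↦y   : ∀ a → f a ≡ x → g a ≡ y
    y↦x   : ∀ a → f a ≡ y → g a ≡ x
    other : ∀ a → f a ≢ x → f a ≢ y → g a ≡ f a
open Toggled

toggled-sym : {A : Set} {x y : A} {f g : A → A} → Toggled x y f g → Toggled y x f g
toggled-sym t = record { x↦y = y↦x t ; y↦x = x↦y t ; other = λ a p q → other t a q p }

least : ∀ {P : ℕ → Set} → (∀ n → Dec (P n)) → ∀ n → P n →
        ∃ λ k → P k × (∀ i → i < k → ¬ P i)
least P? n p with P? 0
least P? n p | yes p₀ = 0 , p₀ , λ _ ()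
least P? zero p | no ¬p₀ = ⊥-elim (¬p₀ p)
least {P} P? (suc n) p | no ¬p₀ with least {P ∘ suc} (P? ∘ suc) n p
... | k , pk , min = suc k , pk , λ { zero _ → ¬p₀ ; (suc i) (s≤s i<k) → min i i<k }

infix 4 _≼_
-- The relation between face numbers that is needed for embeddings: by Euler's formula, losing
-- `2 * j` faces raises the genus by `j`.
_≼_ : ℕ → ℕ → Set
F′ ≼ F = ∃ λ j → F ≡ 2 * j + F′

module Orbits {A : Set} (_≟_ : DecidableEquality A) where

  swap : A → A → A → A
  swap x y a with a ≟ x
  ... | yes _ = y
  ... | no  _ with a ≟ y
  ...   | yes _ = x
  ...   | no  _ = a

  swap-left : ∀ x y → swap x y x ≡ y
  swap-left x y with x ≟ x
  ... | yes _ = refl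
  ... | no n  = ⊥-elim (n refl)

  swap-right : ∀ x y → swap x y y ≡ x
  swap-right x y with y ≟ x
  ... | yes y≡x = y≡x
  ... | no _ with y ≟ y
  ...   | yes _ = refl
  ...   | no n  = ⊥-elim (n refl)

  swap-other : ∀ {x y a} → a ≢ x → a ≢ y → swap x y a ≡ a
  swap-other {x} {y} {a} a≢x a≢y with a ≟ x
  ... | yes p = ⊥-elim (a≢x p)
  ... | no  _ with a ≟ y
  ...   | yes p = ⊥-elim (a≢y p)
  ...   | no  _ = refl

  swap-involutive : ∀ x y a → swap x y (swap x y a) ≡ a
  swap-involutive x y a with a ≟ x
  ... | yes a≡x = trans (swap-right x y) (sym a≡x)
  ... | no a≢x with a ≟ y
  ...   | yes a≡y = trans (swap-left x y) (sym a≡y)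
  ...   | no a≢y  = swap-other a≢x a≢y

  swap-toggles : ∀ x y f → Toggled x y f (swap x y ∘ f)
  swap-toggles x y f = record
    { x↦y   = λ a p → trans (cong (swap x y) p) (swap-left x y)
    ; y↦x   = λ a p → trans (cong (swap x y) p) (swap-right x y)
    ; other = λ a p q → swap-other p q }

  swap-sym : ∀ x y a → swap x y a ≡ swap y x a
  swap-sym x y a = cases (a ≟ x) (a ≟ y)
    where
    cases : Dec (a ≡ x) → Dec (a ≡ y) → swap x y a ≡ swap y x a
    cases (yes refl) _          = trans (swap-left a y) (sym (swap-right y a))
    cases (no _)     (yes refl) = trans (swap-right x a) (sym (swap-left a x))
    cases (no a≢x)   (no a≢y)   = trans (swap-other a≢x a≢y) (sym (swap-other a≢y a≢x))

  swap-natural : ∀ (σ : A → A) → (∀ {a b} → σ a ≡ σ b → a ≡ b) → ∀ x y a → σ (swap x y a) ≡ swap (σ x) (σ y) (σ a)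
  swap-natural σ inj x y a with a ≟ x
  ... | yes refl = sym (swap-left (σ x) (σ y))
  ... | no a≢x with a ≟ y
  ...   | yes refl = sym (swap-right (σ x) (σ y))
  ...   | no a≢y   = sym (swap-other (a≢x ∘ inj) (a≢y ∘ inj))

  swap-untoggles : ∀ x y f → Toggled x y (swap x y ∘ f) f
  swap-untoggles x y f = record
    { x↦y   = λ a p → trans (back a) (trans (cong (swap x y) p) (swap-left x y))
    ; y↦x   = λ a p → trans (back a) (trans (cong (swap x y) p) (swap-right x y))
    ; other = λ a p q → trans (back a) (swap-other p q) }
    where
    back : ∀ a → f a ≡ swap x y (swap x y (f a))
    back a = sym (swap-involutive x y (f a))

  -- The equivalence that arises from the classes of `c` when those of `x` and `y` are united.
  Joined : {C : Set} → (A → C) → A → A → A → A → Set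
  Joined c x y a b = c a ≡ c b ⊎ ((c a ≡ c x ⊎ c a ≡ c y) × (c b ≡ c x ⊎ c b ≡ c y))

  module _ {x y : A} {f g : A → A} (t : Toggled x y f g) where

    -- The maps agree until the `f`-path first steps onto `x` or `y`, where `g` lands on the other
    -- of the two. The part of the path after its last such step is again a path of `g`, so only the
    -- entry point and the exit point matter.
    detour : ∀ k {a b} → iter f k a ≡ b →
             Reach g a b ⊎ ((Reach g a x ⊎ Reach g a y) × (Reach g x b ⊎ Reach g y b))
    detour zero p = inj₁ (0 , p)
    detour (suc k) {a} {b} p with f a ≟ x
    ... | yes fa≡x = inj₂ (inj₂ (reach-≡ (x↦y t a fa≡x)) , last (detour k from-x))
      where
      from-x : iter f k x ≡ b
      from-x = trans (cong (iter f k) (sym fa≡x)) (trans (iter-shift k a) p)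
      last : Reach g x b ⊎ ((Reach g x x ⊎ Reach g x y) × (Reach g x b ⊎ Reach g y b)) →
             Reach g x b ⊎ Reach g y b
      last (inj₁ r)       = inj₁ r
      last (inj₂ (_ , r)) = r
    ... | no fa≢x with f a ≟ y
    ... | yes fa≡y = inj₂ (inj₁ (reach-≡ (y↦x t a fa≡y)) , last (detour k from-y))
      where
      from-y : iter f k y ≡ b
      from-y = trans (cong (iter f k) (sym fa≡y)) (trans (iter-shift k a) p)
      last : Reach g y b ⊎ ((Reach g y x ⊎ Reach g y y) × (Reach g x b ⊎ Reach g y b)) →
             Reach g x b ⊎ Reach g y b
      last (inj₁ r)       = inj₂ r
      last (inj₂ (_ , r)) = r
    ... | no fa≢y = extend (detour k (trans (iter-shift k a) p))
      where
      first : Reach g a (f a)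
      first = reach-≡ (other t a fa≢x fa≢y)
      extend : Reach g (f a) b ⊎ ((Reach g (f a) x ⊎ Reach g (f a) y) × (Reach g x b ⊎ Reach g y b)) →
               Reach g a b ⊎ ((Reach g a x ⊎ Reach g a y) × (Reach g x b ⊎ Reach g y b))
      extend (inj₁ r)            = inj₁ (reach-trans first r)
      extend (inj₂ (inj₁ r , s)) = inj₂ (inj₁ (reach-trans first r) , s)
      extend (inj₂ (inj₂ r , s)) = inj₂ (inj₂ (reach-trans first r) , s)

    -- The `f`-orbit of `x` returns to `x` without meeting `y`, so `g` follows it up to the last
    -- step, which is redirected to `y`.
    cross : ∀ {C : Set} {c : A → C} → OrbitMap f c → c x ≢ c y → Reach g x y
    cross {C} {c} o cx≢cy with reach o (invariant o x)
    ... | k , p = go k x cx≢cy (trans (sym (iter-shift k x)) p)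
      where
      go : ∀ k a → c a ≢ c y → iter f (suc k) a ≡ x → Reach g a y
      go k a ca≢cy p with f a ≟ x
      ... | yes fa≡x = reach-≡ (x↦y t a fa≡x)
      go zero a ca≢cy p | no fa≢x = ⊥-elim (fa≢x p)
      go (suc k) a ca≢cy p | no fa≢x =
        reach-trans (reach-≡ (other t a fa≢x λ fa≡y → cfa≢cy (cong c fa≡y)))
                    (go k (f a) cfa≢cy (trans (iter-shift {f = f} (suc k) a) p))
        where
        cfa≢cy : c (f a) ≢ c y
        cfa≢cy q = ca≢cy (trans (sym (invariant o a)) q)

  module _ {x y : A} {f g : A → A} (t : Toggled x y f g)
           {C D : Set} {c : A → C} (o : OrbitMap f c) (c′ : A → D) where

    -- By `cross` in both directions `x` and `y` lie on one `g`-orbit, so the entry and the exit of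
    -- every detour can be connected.
    merge-orbits : c x ≢ c y → (∀ {a b} → c a ≡ c b → c′ a ≡ c′ b) → c′ x ≡ c′ y →
                   (∀ {a b} → c′ a ≡ c′ b → Joined c x y a b) → OrbitMap g c′
    merge-orbits cx≢cy coarser x≈y joined a b = mk⇔ (to ∘ joined) (invariant-reach inv)
      where
      xy : Reach g x y
      xy = cross t o cx≢cy
      yx : Reach g y x
      yx = cross (toggled-sym t) o (cx≢cy ∘ sym)
      through : ∀ {a b} → Reach g a x ⊎ Reach g a y → Reach g x b ⊎ Reach g y b → Reach g a b
      through (inj₁ r) (inj₁ s) = reach-trans r s
      through (inj₁ r) (inj₂ s) = reach-trans r (reach-trans xy s)
      through (inj₂ r) (inj₁ s) = reach-trans r (reach-trans yx s)
      through (inj₂ r) (inj₂ s) = reach-trans r s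
      keep : ∀ {a b} → c a ≡ c b → Reach g a b
      keep p with reach o p
      ... | k , q with detour t k q
      ... | inj₁ r       = r
      ... | inj₂ (r , s) = through r s
      to : ∀ {a b} → Joined c x y a b → Reach g a b
      to (inj₁ p)                = keep p
      to (inj₂ (inj₁ p , inj₁ q)) = through (inj₁ (keep p)) (inj₁ (keep (sym q)))
      to (inj₂ (inj₁ p , inj₂ q)) = through (inj₁ (keep p)) (inj₂ (keep (sym q)))
      to (inj₂ (inj₂ p , inj₁ q)) = through (inj₂ (keep p)) (inj₁ (keep (sym q)))
      to (inj₂ (inj₂ p , inj₂ q)) = through (inj₂ (keep p)) (inj₂ (keep (sym q)))
      inv : ∀ a → c′ (g a) ≡ c′ a
      inv a with f a ≟ x
      ... | yes fa≡x = trans (cong c′ (x↦y t a fa≡x))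
                         (trans (sym x≈y) (trans (cong c′ (sym fa≡x)) (coarser (invariant o a))))
      ... | no fa≢x with f a ≟ y
      ... | yes fa≡y = trans (cong c′ (y↦x t a fa≡y))
                         (trans x≈y (trans (cong c′ (sym fa≡y)) (coarser (invariant o a))))
      ... | no fa≢y = trans (cong c′ (other t a fa≢x fa≢y)) (coarser (invariant o a))

    -- Since `c′` is constant along `g` and separates `x` from `y`, a detour between points of equal
    -- colour enters and leaves at the same one of the two.
    split-orbits : (∀ a → c′ (g a) ≡ c′ a) → (∀ {a b} → c′ a ≡ c′ b → c a ≡ c b) →
                   c′ x ≢ c′ y → OrbitMap g c′
    split-orbits inv finer x≉y a b = mk⇔ to (invariant-reach inv)
      where
      colour : ∀ {a b} → Reach g a b → c′ a ≡ c′ b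
      colour = invariant-reach inv
      to : c′ a ≡ c′ b → Reach g a b
      to p with reach o (finer p)
      ... | k , q with detour t k q
      ... | inj₁ r = r
      ... | inj₂ (inj₁ r , inj₁ s) = reach-trans r s
      ... | inj₂ (inj₁ r , inj₂ s) = ⊥-elim (x≉y (trans (sym (colour r)) (trans p (sym (colour s)))))
      ... | inj₂ (inj₂ r , inj₁ s) = ⊥-elim (x≉y (trans (colour s) (trans (sym p) (colour r))))
      ... | inj₂ (inj₂ r , inj₂ s) = reach-trans r s

  module _ {x y : A} {f g : A → A} (t : Toggled x y f g) where

    -- The colour of `y` is punched out of `Fin (suc F)`, and its class takes over the colour of
    -- `x`.
    merge-count : ∀ {F} (h : HasOrbits f F) → let c = proj₁ h in c x ≢ c y →
      ∃ λ F′ → F ≡ suc F′ × Σ (HasOrbits g F′) λ h′ → let c′ = proj₁ h′ in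
        (∀ {a b} → c a ≡ c b → c′ a ≡ c′ b) ×
        (∀ {a b} → c′ a ≡ c′ b → Joined c x y a b)
    merge-count {zero} (c , _) _ with c x
    ... | ()
    merge-count {suc F} (c , onto , o) cx≢cy =
      F , refl , (c′ , onto′ , merge-orbits t o c′ cx≢cy coarser x≈y joined) , coarser , joined
      where
      colour : ∀ k → Dec (c y ≡ k) → Fin F
      colour k (yes _) = punchOut (cx≢cy ∘ sym)
      colour k (no n)  = punchOut n
      c′ : A → Fin F
      c′ a = colour (c a) (c y Fin.≟ c a)
      coarser : ∀ {a b} → c a ≡ c b → c′ a ≡ c′ b
      coarser = cong λ k → colour k (c y Fin.≟ k)
      x≈y : c′ x ≡ c′ y
      x≈y with c y Fin.≟ c x | c y Fin.≟ c y
      ... | yes p | _     = ⊥-elim (cx≢cy (sym p))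
      ... | no _  | no n  = ⊥-elim (n refl)
      ... | no _  | yes _ = Fin.punchOut-cong (c y) refl
      joined : ∀ {a b} → c′ a ≡ c′ b → Joined c x y a b
      joined {a} {b} eq with c y Fin.≟ c a | c y Fin.≟ c b
      ... | yes p | yes q = inj₁ (trans (sym p) q)
      ... | yes p | no q  = inj₂ (inj₂ (sym p) , inj₁ (sym (Fin.punchOut-injective (cx≢cy ∘ sym) q eq)))
      ... | no p  | yes q = inj₂ (inj₁ (Fin.punchOut-injective p (cx≢cy ∘ sym) eq) , inj₂ (sym q))
      ... | no p  | no q  = inj₁ (Fin.punchOut-injective p q eq)
      onto′ : ∀ j → ∃ λ a → c′ a ≡ j
      onto′ j with onto (punchIn (c y) j)
      ... | a , p = a , lem
        where
        lem : c′ a ≡ j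
        lem with c y Fin.≟ c a
        ... | yes q = ⊥-elim (Fin.punchInᵢ≢i (c y) j (sym (trans q p)))
        ... | no n  = trans (Fin.punchOut-cong (c y) p) (Fin.punchOut-punchIn (c y))

    -- Cut the common orbit at the first time `suc k` at which the iterates of `x` meet `y`. The arc
    -- before that time gets the new colour `zero`; every other point keeps its old colour, shifted
    -- by `suc`.
    split-count : (∀ {a b} → f a ≡ f b → a ≡ b) → x ≢ y →
      ∀ {F} (h : HasOrbits f F) → let c = proj₁ h in c x ≡ c y →
      Σ (HasOrbits g (suc F)) λ h′ → let c′ = proj₁ h′ in
        (∀ {a b} → c′ a ≡ c′ b → c a ≡ c b) × c′ x ≢ c′ y ×
        (∀ a → c a ≡ c x → c′ a ≡ c′ x ⊎ c′ a ≡ c′ y)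
    split-count inj x≢y {F} (c , onto , o) cx≡cy
      with least (λ i → iter f i x ≟ y) (proj₁ (reach o cx≡cy)) (proj₂ (reach o cx≡cy))
    ... | zero , end , _ = ⊥-elim (x≢y end)
    ... | suc k , end , min =
      (c′ , onto′ , split-orbits t o c′ inv finer x≉y) , finer , x≉y , halves
      where
      -- The f-arc from x up to, but excluding, y is one of the two new orbits.
      Arc : A → Set
      Arc a = ∃ λ i → i < suc k × iter f i x ≡ a
      arc? : ∀ a → Dec (Arc a)
      arc? a = anyUpTo? (λ i → iter f i x ≟ a) (suc k)
      x∈ : Arc x
      x∈ = 0 , s≤s z≤n , refl
      y∉ : ¬ Arc y
      y∉ (i , i<k , p) = min i i<k p
      -- A return to `x` inside the arc could be cut out, giving an earlier visit to `y`.
      noReturn : ∀ i → suc i < suc k → iter f (suc i) x ≢ x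
      noReturn i i<k p = min (suc k ∸ suc i) (∸-monoʳ-< (s≤s z≤n) (<⇒≤ i<k))
        (trans (cong (iter f (suc k ∸ suc i)) (sym p))
        (trans (sym (iter-+ (suc k ∸ suc i) (suc i) x))
        (trans (cong (λ m → iter f m x) (m∸n+n≡m (<⇒≤ i<k))) end)))
      forward : ∀ {a} → Arc a → Arc (g a)
      forward {a} (i , s≤s i≤k , p) with m≤n⇒m<n∨m≡n i≤k
      ... | inj₂ refl = subst Arc (sym (y↦x t a (trans (cong f (sym p)) end))) x∈
      ... | inj₁ i<k  = suc i , s≤s i<k , trans (cong f p) (sym (other t a
        (λ q → noReturn i (s≤s i<k) (trans (cong f p) q))
        (λ q → min (suc i) (s≤s i<k) (trans (cong f p) q))))
      backward : ∀ {a} → Arc (g a) → Arc a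
      backward {a} ga∈ with f a ≟ x
      ... | yes p = ⊥-elim (y∉ (subst Arc (x↦y t a p) ga∈))
      ... | no fa≢x with f a ≟ y
      ... | yes p = k , n<1+n k , inj (trans end (sym p))
      backward {a} ga∈ | no fa≢x | no fa≢y with subst Arc (other t a fa≢x fa≢y) ga∈
      ... | zero , _ , p = ⊥-elim (fa≢x (sym p))
      ... | suc i , i<k , p = i , <⇒≤ i<k , inj p
      colour : ∀ a → Dec (Arc a) → Fin (suc F)
      colour a (yes _) = zero
      colour a (no _)  = suc (c a)
      c′ : A → Fin (suc F)
      c′ a = colour a (arc? a)
      arc-colour : ∀ {a} → Arc a → c a ≡ c x
      arc-colour (i , _ , p) = sym (sameColour o (i , p))
      inv : ∀ a → c′ (g a) ≡ c′ a
      inv a with arc? (g a) | arc? a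
      ... | yes p | yes q = refl
      ... | yes p | no q  = ⊥-elim (q (backward p))
      ... | no p  | yes q = ⊥-elim (p (forward q))
      ... | no p  | no q  = cong suc (trans cga≡cfa (invariant o a))
        where
        cga≡cfa : c (g a) ≡ c (f a)
        cga≡cfa with f a ≟ x
        ... | yes r = trans (cong c (x↦y t a r)) (trans (sym cx≡cy) (cong c (sym r)))
        ... | no r with f a ≟ y
        ... | yes s = trans (cong c (y↦x t a s)) (trans cx≡cy (cong c (sym s)))
        ... | no s  = cong c (other t a r s)
      finer : ∀ {a b} → c′ a ≡ c′ b → c a ≡ c b
      finer {a} {b} eq with arc? a | arc? b
      finer eq   | yes p | yes q = trans (arc-colour p) (sym (arc-colour q))
      finer ()   | yes p | no q
      finer ()   | no p  | yes q
      finer eq   | no p  | no q  = Fin.suc-injective eq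
      x≉y : c′ x ≢ c′ y
      x≉y eq with arc? x | arc? y
      x≉y eq | no p  | _     = p x∈
      x≉y eq | yes _ | yes q = y∉ q
      x≉y () | yes _ | no _
      halves : ∀ a → c a ≡ c x → c′ a ≡ c′ x ⊎ c′ a ≡ c′ y
      halves a ca≡cx with arc? a | arc? x | arc? y
      ... | _     | no p  | _     = ⊥-elim (p x∈)
      ... | _     | _     | yes p = ⊥-elim (y∉ p)
      ... | yes _ | yes _ | no _  = inj₁ refl
      ... | no _  | yes _ | no _  = inj₂ (cong suc (trans ca≡cx cx≡cy))
      onto′ : ∀ j → ∃ λ a → c′ a ≡ j
      onto′ zero = x , lem
        where
        lem : c′ x ≡ zero
        lem with arc? x
        ... | yes _ = refl
        ... | no p  = ⊥-elim (p x∈)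
      onto′ (suc j) with onto j
      ... | a , p with arc? a in eq
      ... | no _ = a , lem
        where
        lem : c′ a ≡ suc j
        lem rewrite eq = cong suc p
      -- The found point of colour `j` has moved to the new class; `y` remains in the old one.
      ... | yes q = y , lem
        where
        lem : c′ y ≡ suc j
        lem with arc? y
        ... | yes r = ⊥-elim (y∉ r)
        ... | no _  = cong suc (trans (sym cx≡cy) (trans (sym (arc-colour q)) p))

  swap-invariant : ∀ {C : Set} {c : A → C} {x y} → c x ≡ c y → ∀ a → c (swap x y a) ≡ c a
  swap-invariant {c = c} {x} {y} p a with a ≟ x
  ... | yes refl = sym p
  ... | no _ with a ≟ y
  ...   | yes refl = p
  ...   | no _     = refl

  swap-injective : ∀ x y {a b} → swap x y a ≡ swap x y b → a ≡ b
  swap-injective x y {a} {b} p =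
    trans (sym (swap-involutive x y a)) (trans (cong (swap x y) p) (swap-involutive x y b))

  -- The 3-cycle from `x` to `y` to `z` and back to `x`, as two transpositions, each of which
  -- changes the number of orbits by one.
  rot3 : A → A → A → A → A
  rot3 x y z a = swap x z (swap x y a)

  module _ {x y z : A} where

    rot3-x : y ≢ x → y ≢ z → rot3 x y z x ≡ y
    rot3-x y≢x y≢z = trans (cong (swap x z) (swap-left x y)) (swap-other y≢x y≢z)

    rot3-y : rot3 x y z y ≡ z
    rot3-y = trans (cong (swap x z) (swap-right x y)) (swap-left x z)

    rot3-z : z ≢ x → z ≢ y → rot3 x y z z ≡ x
    rot3-z z≢x z≢y = trans (cong (swap x z) (swap-other z≢x z≢y)) (swap-right x z)

    rot3-other : ∀ {a} → a ≢ x → a ≢ y → a ≢ z → rot3 x y z a ≡ a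
    rot3-other a≢x a≢y a≢z = trans (cong (swap x z) (swap-other a≢x a≢y)) (swap-other a≢x a≢z)

  -- Lets `exchange` pass from the faces of `R₁` to those of `R₄`: their face permutations differ by
  -- two disjoint transpositions.
  rot3-exchange : ∀ {a b c d} → a ≢ b → a ≢ c → a ≢ d → c ≢ b → b ≢ d → c ≢ d →
                  ∀ t → swap a d (swap b c (rot3 a c b t)) ≡ rot3 b d a t
  rot3-exchange {a} {b} {c} {d} a≢b a≢c a≢d c≢b b≢d c≢d t =
    cases (t ≟ a) (t ≟ b) (t ≟ c) (t ≟ d)
    where
    chain : ∀ {t t₁ t₂ t₃} → rot3 a c b t ≡ t₁ → swap b c t₁ ≡ t₂ → swap a d t₂ ≡ t₃ →
            rot3 b d a t ≡ t₃ → swap a d (swap b c (rot3 a c b t)) ≡ rot3 b d a t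
    chain p q r s =
      trans (cong (swap a d ∘ swap b c) p) (trans (cong (swap a d) q) (trans r (sym s)))
    cases : Dec (t ≡ a) → Dec (t ≡ b) → Dec (t ≡ c) → Dec (t ≡ d) →
            swap a d (swap b c (rot3 a c b t)) ≡ rot3 b d a t
    cases (yes refl) _ _ _ = chain (rot3-x (a≢c ∘ sym) c≢b) (swap-right b c)
      (swap-other (a≢b ∘ sym) b≢d) (rot3-z a≢b a≢d)
    cases _ (yes refl) _ _ = chain (rot3-z (a≢b ∘ sym) (c≢b ∘ sym)) (swap-other a≢b a≢c)
      (swap-left a d) (rot3-x (b≢d ∘ sym) (a≢d ∘ sym))
    cases _ _ (yes refl) _ = chain rot3-y (swap-left b c)
      (swap-other (a≢c ∘ sym) c≢d) (rot3-other c≢b c≢d (a≢c ∘ sym))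
    cases _ _ _ (yes refl) = chain (rot3-other (a≢d ∘ sym) (c≢d ∘ sym) (b≢d ∘ sym))
      (swap-other (b≢d ∘ sym) (c≢d ∘ sym)) (swap-right a d) rot3-y
    cases (no t≢a) (no t≢b) (no t≢c) (no t≢d) = chain (rot3-other t≢a t≢c t≢b)
      (swap-other t≢b t≢c) (swap-other t≢a t≢d) (rot3-other t≢b t≢d t≢a)

  Distinct3 : {C : Set} → (A → C) → A → A → A → Set
  Distinct3 c x y z = c x ≢ c y × c x ≢ c z × c y ≢ c z

  -- Merging the orbits of `x` and `y` leaves that of `z` apart, so the second transposition merges
  -- as well.
  merge3 : ∀ x y z {f F} (h : HasOrbits f F) → Distinct3 (proj₁ h) x y z →
           ∃ λ F′ → F ≡ 2 + F′ × HasOrbits (rot3 x y z ∘ f) F′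
  merge3 x y z {f} h (x≉y , x≉z , y≉z) with merge-count (swap-toggles x y f) h x≉y
  ... | F₁ , refl , h₁ , coarser , joined with merge-count (swap-toggles x z (swap x y ∘ f)) h₁ x≉z′
    where
    x≉z′ : proj₁ h₁ x ≢ proj₁ h₁ z
    x≉z′ p with joined p
    ... | inj₁ q            = x≉z q
    ... | inj₂ (_ , inj₁ q) = x≉z (sym q)
    ... | inj₂ (_ , inj₂ q) = y≉z (sym q)
  ... | F₂ , refl , h₂ , _ = F₂ , refl , h₂

  -- The number of orbits grows only if both transpositions split. The first then separates `x` from
  -- `y`, and the second cuts `z` off from `x` within one of the new orbits.
  toggle3 : ∀ x y z {f F} → (∀ {a b} → f a ≡ f b → a ≡ b) → x ≢ y → x ≢ z → HasOrbits f F →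
            (∃ λ F′ → F′ ≼ F × HasOrbits (rot3 x y z ∘ f) F′) ⊎
            Σ (HasOrbits (rot3 x y z ∘ f) (2 + F)) λ h → Distinct3 (proj₁ h) x y z
  toggle3 x y z {f} {F} inj x≢y x≢z h with proj₁ h x Fin.≟ proj₁ h y
  toggle3 x y z {f} {F} inj x≢y x≢z h | no x≉y with merge-count (swap-toggles x y f) h x≉y
  ... | F₁ , refl , h₁ , _ with proj₁ h₁ x Fin.≟ proj₁ h₁ z
  ... | yes x≈z = inj₁ (suc F₁ , (0 , refl) ,
    proj₁ (split-count (swap-toggles x z _) (inj ∘ swap-injective x y) x≢z h₁ x≈z))
  ... | no x≉z with merge-count (swap-toggles x z _) h₁ x≉z
  ... | F₂ , refl , h₂ , _ = inj₁ (F₂ , (1 , refl) , h₂)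
  toggle3 x y z {f} {F} inj x≢y x≢z h | yes x≈y with split-count (swap-toggles x y f) inj x≢y h x≈y
  ... | h₁ , _ , x≉y , _ with proj₁ h₁ x Fin.≟ proj₁ h₁ z
  ... | no x≉z with merge-count (swap-toggles x z _) h₁ x≉z
  ... | F₂ , refl , h₂ , _ = inj₁ (F₂ , (0 , refl) , h₂)
  toggle3 x y z {f} {F} inj x≢y x≢z h | yes x≈y | h₁ , _ , x≉y , _ | yes x≈z
    with split-count (swap-toggles x z _) (inj ∘ swap-injective x y) x≢z h₁ x≈z
  ... | h₂ , finer , x≉z , _ =
    inj₂ (h₂ , (x≉y ∘ finer) , x≉z , λ p → x≉y (trans x≈z (sym (finer p))))

  -- The transposition of `b` and `c` merges their two orbits; that of `a` and `d` then splits their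
  -- common orbit, so the total is unchanged.
  exchange : ∀ a b c d {f F} → (∀ {s t} → f s ≡ f t → s ≡ t) → a ≢ d →
    (h : HasOrbits f F) → let col = proj₁ h in Distinct3 col a c b → col d ≡ col a →
    Σ (HasOrbits (swap a d ∘ swap b c ∘ f) F) λ h′ → let col′ = proj₁ h′ in
      Distinct3 col′ a d b × Distinct3 col′ a d c ×
      (∀ t → col t ≡ col a → col′ t ≡ col′ a ⊎ col′ t ≡ col′ d)
  exchange a b c d {f} inj a≢d h (a≉c , a≉b , c≉b) d≈a
    with merge-count (swap-toggles b c f) h (c≉b ∘ sym)
  ... | F₁ , refl , h₁ , coarser , joined
    with split-count (swap-toggles a d _) (inj ∘ swap-injective b c) a≢d h₁ (coarser (sym d≈a))
  ... | h₂ , finer , a≉d , halves =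
    h₂ , (a≉d , a≉₁ b a≉b ∘ finer , d≉ b a≉b ∘ finer) , (a≉d , a≉₁ c a≉c ∘ finer , d≉ c a≉c ∘ finer)
       , λ t p → halves t (coarser p)
    where
    a≉₁ : ∀ t → proj₁ h a ≢ proj₁ h t → proj₁ h₁ a ≢ proj₁ h₁ t
    a≉₁ t a≉t p with joined p
    ... | inj₁ q            = a≉t q
    ... | inj₂ (inj₁ q , _) = a≉b q
    ... | inj₂ (inj₂ q , _) = a≉c q
    d≉ : ∀ t → proj₁ h a ≢ proj₁ h t → proj₁ h₁ d ≢ proj₁ h₁ t
    d≉ t a≉t p = a≉₁ t a≉t (trans (coarser (sym d≈a)) p)

-- Orbits of pointwise equal maps and of first-return maps.

module _ {A : Set} {f g : A → A} (f≗g : ∀ a → f a ≡ g a) where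

  iter-cong : ∀ k a → iter f k a ≡ iter g k a
  iter-cong zero    a = refl
  iter-cong (suc k) a = trans (f≗g _) (cong g (iter-cong k a))

  orbitMap-cong : {C : Set} {c : A → C} → OrbitMap f c → OrbitMap g c
  orbitMap-cong o a b = mk⇔
    (λ p → let k , q = reach o p in k , trans (sym (iter-cong k a)) q)
    (λ (k , q) → sameColour o (k , trans (iter-cong k a) q))

-- g is the first-return map of f to the image of i; r sends a point to the first point of the image
-- on its forward orbit.
module FirstReturn {A B : Set} {f : A → A} {g : B → B} (i : B → A) (r : A → B)
  (r∘i : ∀ b → r (i b) ≡ b) (next : ∀ b → r (f (i b)) ≡ g b)
  (skip : ∀ a → (∃ λ b → a ≡ i b) ⊎ r (f a) ≡ r a) (exit : ∀ a → Reach f a (i (r a))) where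

  project : ∀ {a a′} → Reach f a a′ → Reach g (r a) (r a′)
  project {a} (zero  , p) = 0 , cong r p
  project {a} (suc k , p) with project {a} (k , refl) | skip (iter f k a)
  ... | s | inj₂ q       = subst (Reach g (r a)) (trans (sym q) (cong r p)) s
  ... | s | inj₁ (b , q) = reach-trans s (reach-≡
    (trans (cong (λ t → g (r t)) q) (trans (cong g (r∘i b))
      (trans (sym (next b)) (trans (cong (λ t → r (f t)) (sym q)) (cong r p))))))

  lift : ∀ {b b′} → Reach g b b′ → Reach f (i b) (i b′)
  lift {b} (zero  , p) = 0 , cong i p
  lift {b} (suc k , p) = reach-trans (lift (k , refl)) (reach-trans reach-step
    (subst (Reach f _) (cong i (trans (next _) p)) (exit _)))

  module _ {C : Set} where

    down : {c : A → C} → OrbitMap f c → OrbitMap g (c ∘ i)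
    down o b b′ = mk⇔
      (λ p → subst (λ t → Reach g t b′) (r∘i b) (subst (Reach g _) (r∘i b′) (project (reach o p))))
      (sameColour o ∘ lift)

    -- `exit` leads from `a` into the image of `i`, the `g`-path is lifted there, and `enter`
    -- supplies the way out to `a′`.
    up : (∀ a → ∃ λ b → Reach f (i b) a) → {c : B → C} → OrbitMap g c → OrbitMap f (c ∘ r)
    up enter {c} o a a′ = mk⇔ to (sameColour o ∘ project)
      where
      to : c (r a) ≡ c (r a′) → Reach f a a′
      to p with enter a′
      ... | b , s = reach-trans (exit a) (reach-trans
        (lift (reach o (trans p (trans (sym (sameColour o (project s))) (cong c (r∘i b)))))) s)

  down-count : ∀ {F} → HasOrbits f F → HasOrbits g F
  down-count (c , onto , o) = c ∘ i , (λ j → let a , p = onto j in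
    r a , trans (sym (sameColour o (exit a))) p) , down o

  up-count : (∀ a → ∃ λ b → Reach f (i b) a) → ∀ {F} → HasOrbits g F → HasOrbits f F
  up-count enter (c , onto , o) = c ∘ r , (λ j → let b , p = onto j in
    i b , trans (cong c (r∘i b)) p) , up enter o

-- Rotations as permutations with prescribed orbits, and moving one dart.

module _ {n : ℕ} where

  infix 4 _≟ᵈ_
  abstract
    _≟ᵈ_ : DecidableEquality (Fin n × Bool)
    _≟ᵈ_ = ≡-dec Fin._≟_ Bool._≟_

  open Orbits _≟ᵈ_ public

module _ {G : Graph} where

  flip-flip : ∀ d → flip G (flip G d) ≡ d
  flip-flip (e , b) = cong (e ,_) (Bool.not-involutive b)

  flip-injective : ∀ {d d′} → flip G d ≡ flip G d′ → d ≡ d′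
  flip-injective {d} {d′} p = trans (sym (flip-flip d)) (trans (cong (flip G) p) (flip-flip d′))

  -- A rotation is a permutation whose orbits are the sets of darts at one vertex, so orbit
  -- colourings describe vertices and faces alike.
  mkRotation : (p : Dart G ↔ Dart G) → OrbitMap (Inverse.to p) (vert G) → Rotation G
  mkRotation p o = record { ρ = p ; local = invariant o ; cyclic = λ d d′ → reach o }

  next : Rotation G → Dart G → Dart G
  next R = Inverse.to (ρ R)

  next-orbits : (R : Rotation G) → OrbitMap (next R) (vert G)
  next-orbits R d d′ = mk⇔ (cyclic R d d′) (invariant-reach (local R))

  next-injective : (R : Rotation G) → ∀ {d d′} → next R d ≡ next R d′ → d ≡ d′
  next-injective R {d} {d′} p = trans (sym (Inverse.strictlyInverseʳ (ρ R) d))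
    (trans (cong (Inverse.from (ρ R)) p) (Inverse.strictlyInverseʳ (ρ R) d′))

  face-injective : (R : Rotation G) → ∀ {d d′} → facePerm G R d ≡ facePerm G R d′ → d ≡ d′
  face-injective R = flip-injective ∘ next-injective R

  swapAfter : Dart G → Dart G → Dart G ↔ Dart G → Dart G ↔ Dart G
  swapAfter x y p = mk↔ₛ′ (swap x y ∘ Inverse.to p) (Inverse.from p ∘ swap x y)
    (λ d → trans (cong (swap x y) (Inverse.strictlyInverseˡ p _)) (swap-involutive x y d))
    (λ d → trans (cong (Inverse.from p) (swap-involutive x y _)) (Inverse.strictlyInverseʳ p d))

  -- Takes the dart x out of the rotation and reinserts it just before z.
  module Move (R : Rotation G) (x q z : Dart G) (x↦q : next R x ≡ q)
              (x≢q : x ≢ q) (x≢z : x ≢ z) (q≢z : q ≢ z) (z-at : vert G z ≡ vert G x) where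

    private
      mark : ∀ d → Dec (d ≡ x) → Maybe (Fin (V G))
      mark d (yes _) = nothing
      mark d (no _)  = just (vert G d)

      -- Once `x` is taken out it is a fixed point, hence an orbit of its own, with colour
      -- `nothing`.
      colour : Dart G → Maybe (Fin (V G))
      colour d = mark d (d ≟ᵈ x)

      removed : Dart G → Dart G
      removed = swap x q ∘ next R

      q-at : vert G x ≡ vert G q
      q-at = trans (sym (local R x)) (cong (vert G) x↦q)

      removed-x : removed x ≡ x
      removed-x = trans (cong (swap x q) x↦q) (swap-right x q)

      removed-≢x : ∀ d → d ≢ x → removed d ≢ x
      removed-≢x d d≢x p = d≢x (next-injective R (swap-injective x q (trans p (sym removed-x))))

      inv : ∀ d → colour (removed d) ≡ colour d
      inv d with d ≟ᵈ x | removed d ≟ᵈ x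
      ... | yes p    | yes _ = refl
      ... | yes refl | no n  = ⊥-elim (n removed-x)
      ... | no n     | yes p = ⊥-elim (removed-≢x d n p)
      ... | no _     | no _  = cong just (trans (swap-invariant {c = vert G} q-at (next R d)) (local R d))

      finer : ∀ {d d′} → colour d ≡ colour d′ → vert G d ≡ vert G d′
      finer {d} {d′} p with d ≟ᵈ x | d′ ≟ᵈ x
      finer p  | yes refl | yes refl = refl
      finer () | yes _    | no _
      finer () | no _     | yes _
      finer p  | no _     | no _     = just-injective p

      colour-x : ∀ {d} → d ≡ x → colour d ≡ nothing
      colour-x {d} p with d ≟ᵈ x
      ... | yes _ = refl
      ... | no n  = ⊥-elim (n p)

      colour-≢x : ∀ {d} → d ≢ x → colour d ≡ just (vert G d)
      colour-≢x {d} n with d ≟ᵈ x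
      ... | yes p = ⊥-elim (n p)
      ... | no _  = refl

      x≉ : ∀ {d} → d ≢ x → colour x ≢ colour d
      x≉ n p with trans (sym (colour-x refl)) (trans p (colour-≢x n))
      ... | ()

      ≈z : ∀ {d} → d ≢ x → vert G d ≡ vert G x → colour d ≡ colour z
      ≈z n p = trans (colour-≢x n) (trans (cong just (trans p (sym z-at))) (sym (colour-≢x (x≢z ∘ sym))))

      joined : ∀ {d d′} → vert G d ≡ vert G d′ → Joined colour x z d d′
      joined {d} {d′} p = cases (d ≟ᵈ x) (d′ ≟ᵈ x)
        where
        cases : Dec (d ≡ x) → Dec (d′ ≡ x) → Joined colour x z d d′
        cases (yes q) (yes q′) = inj₁ (trans (colour-x q) (sym (colour-x q′)))
        cases (yes q) (no n)   = inj₂ (inj₁ (cong colour q) , inj₂ (≈z n (trans (sym p) (cong (vert G) q))))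
        cases (no n) (yes q)   = inj₂ (inj₂ (≈z n (trans p (cong (vert G) q))) , inj₁ (cong colour q))
        cases (no n) (no n′)   = inj₁ (trans (colour-≢x n) (trans (cong just p) (sym (colour-≢x n′))))

    move : Rotation G
    move = mkRotation (swapAfter x z (swapAfter x q (ρ R)))
      -- The inner transposition splits `x` off from its vertex; the outer one merges it back in
      -- front of `z`.
      (merge-orbits (swap-toggles x z removed)
        (split-orbits (swap-toggles x q (next R)) (next-orbits R) colour inv finer (x≉ (x≢q ∘ sym)))
        (vert G) (x≉ (x≢z ∘ sym)) finer (sym z-at) joined)

  open Move public using (move)

  -- Breaking the alternation at a vertex of degree four without gaining faces.

  module Improve {v : Fin (V G)} (R : Rotation G) {F} (h : HasOrbits (facePerm G R) F)
    {a c b d : Dart G} (a-at : vert G a ≡ v)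
    (a↦c : next R a ≡ c) (c↦b : next R c ≡ b) (b↦d : next R b ≡ d) (d↦a : next R d ≡ a)
    (a≢c : a ≢ c) (a≢b : a ≢ b) (a≢d : a ≢ d) (c≢b : c ≢ b) (c≢d : c ≢ d) (b≢d : b ≢ d) where

    -- In the rotation `(a c b d)` the dart two places after `a` is `b`, on the same side as `a` if
    -- the sides alternate. Having `c` or `d` in that place excludes alternation.
    Improved : Set
    Improved = ∃ λ R′ → ∃ λ F′ → F′ ≼ F × HasOrbits (facePerm G R′) F′ ×
      (next R′ (next R′ a) ≡ c ⊎ next R′ (next R′ a) ≡ d)

    private
      at : ∀ {s t} → next R s ≡ t → vert G t ≡ vert G s
      at {s} p = trans (cong (vert G) (sym p)) (local R s)

      c-at : vert G c ≡ vert G a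
      c-at = at a↦c

      b-at : vert G b ≡ vert G a
      b-at = trans (at c↦b) c-at

      d-at : vert G d ≡ vert G a
      d-at = trans (at b↦d) b-at

      -- At `v`, `R₁` is `(a b d c)` and `R₄` is `(a c d b)`, its reversal.
      R₁ R₄ : Rotation G
      R₁ = move R a c b a↦c a≢c a≢b c≢b b-at
      R₄ = move R b d a b↦d b≢d (a≢b ∘ sym) (a≢d ∘ sym) (sym b-at)

      φ₁ φ₄ : Dart G → Dart G
      φ₁ = facePerm G R₁
      φ₄ = facePerm G R₄

      a↦₁b : next R₁ a ≡ b
      a↦₁b = trans (cong (rot3 a c b) a↦c) rot3-y

      c↦₁a : next R₁ c ≡ a
      c↦₁a = trans (cong (rot3 a c b) c↦b) (rot3-z (a≢b ∘ sym) (c≢b ∘ sym))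

      b↦₁d : next R₁ b ≡ d
      b↦₁d = trans (cong (rot3 a c b) b↦d) (rot3-other (a≢d ∘ sym) (c≢d ∘ sym) (b≢d ∘ sym))

      d↦₁c : next R₁ d ≡ c
      d↦₁c = trans (cong (rot3 a c b) d↦a) (rot3-x (a≢c ∘ sym) c≢b)

      a↦₄c : next R₄ a ≡ c
      a↦₄c = trans (cong (rot3 b d a) a↦c) (rot3-other c≢b c≢d (a≢c ∘ sym))

      c↦₄d : next R₄ c ≡ d
      c↦₄d = trans (cong (rot3 b d a) c↦b) (rot3-x (b≢d ∘ sym) (a≢d ∘ sym))

      twice : ∀ R′ {s t u} → next R′ s ≡ t → next R′ t ≡ u → next R′ (next R′ s) ≡ u
      twice R′ p q = trans (cong (next R′) p) q

      distinct : ∀ {k} {col : Dart G → Fin k} {x y z} → Distinct3 col x y z → x ≢ y × x ≢ z × y ≢ z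
      distinct {col = col} (p , q , r) = p ∘ cong col , q ∘ cong col , r ∘ cong col

      -- The move of `x` to the place before `z` composes the face permutation with the same `rot3`
      -- as the rotation, so `merge3` applies.
      merge-at : ∀ R′ (h′ : HasOrbits (facePerm G R′) (2 + F)) x z → vert G z ≡ vert G x →
        (D : Distinct3 (proj₁ h′) x (next R′ x) z) →
        ∃ λ R″ → HasOrbits (facePerm G R″) F × (∀ t → next R″ t ≡ rot3 x (next R′ x) z (next R′ t))
      merge-at R′ h′ x z z-at D with distinct {col = proj₁ h′} D | merge3 x (next R′ x) z h′ D
      ... | x≢q , x≢z , q≢z | _ , p , h″ with suc-injective (suc-injective p)
      ... | refl = move R′ x (next R′ x) z refl x≢q x≢z q≢z z-at , h″ , λ _ → refl

    module _ (f : Dart G) (f-at : vert G f ≡ vert G (flip G a))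
      (f-to : vert G (flip G f) ≡ vert G (flip G c))
      (a-far : vert G (flip G a) ≢ v) (c-far : vert G (flip G c) ≢ v) where

      private
        -- A move at a vertex other than `v` leaves the rotation at `v` as it is, and with it the
        -- condition on the dart two places after `a`.
        merge-away : ∀ R′ (h′ : HasOrbits (facePerm G R′) (2 + F)) x z →
          vert G x ≢ v → vert G z ≡ vert G x → Distinct3 (proj₁ h′) x (next R′ x) z →
          (next R′ (next R′ a) ≡ c ⊎ next R′ (next R′ a) ≡ d) → Improved
        merge-away R′ h′ x z x-far z-at D keep with merge-at R′ h′ x z z-at D
        ... | R″ , h″ , eq = R″ , F , (0 , refl) , h″ , keep′ keep
          where
          away : ∀ {s t} → vert G s ≡ vert G x → vert G t ≡ v → t ≢ s
          away s-at t-at refl = x-far (trans (sym s-at) t-at)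
          same : ∀ t → vert G t ≡ v → next R″ t ≡ next R′ t
          same t t-at = trans (eq t) (rot3-other (away refl t-at′) (away (local R′ x) t-at′) (away z-at t-at′))
            where
            t-at′ : vert G (next R′ t) ≡ v
            t-at′ = trans (local R′ t) t-at
          eq² : next R″ (next R″ a) ≡ next R′ (next R′ a)
          eq² = trans (cong (next R″) (same a a-at)) (same _ (trans (local R′ a) a-at))
          keep′ : _ → _
          keep′ (inj₁ p) = inj₁ (trans eq² p)
          keep′ (inj₂ p) = inj₂ (trans eq² p)

        module Around (R′ : Rotation G) {k} (h′ : HasOrbits (facePerm G R′) k) where

          col : Dart G → Fin k
          col = proj₁ h′

          -- The face permutation takes `flip G s` to `next R′ s`. Together with `out` this locates
          -- far ends on the faces of darts at `v`.
          into : ∀ {s t} → next R′ s ≡ t → col (flip G s) ≡ col t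
          into {s} p = trans (sym (invariant (proj₂ (proj₂ h′)) (flip G s)))
            (cong col (trans (cong (next R′) (flip-flip s)) p))

          out : ∀ s → col (next R′ (flip G s)) ≡ col s
          out = invariant (proj₂ (proj₂ h′))

          alter : ∀ {x y z x′ y′ z′} → col x ≡ col x′ → col y ≡ col y′ → col z ≡ col z′ →
            Distinct3 col x′ y′ z′ → Distinct3 col x y z
          alter p q r (x≉y , x≉z , y≉z) =
            (λ s → x≉y (trans (sym p) (trans s q))) ,
            (λ s → x≉z (trans (sym p) (trans s r))) ,
            (λ s → y≉z (trans (sym q) (trans s r)))

        separated : (h₁ : HasOrbits φ₁ (2 + F)) → Distinct3 (proj₁ h₁) a c b → Improved
        separated h₁ (a≉c , a≉b , c≉b) = cases (col d Fin.≟ col a) (col d Fin.≟ col b)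
          where
          open Around R₁ h₁
          conclude : ∀ {x z t} →
            (∃ λ R″ → HasOrbits (facePerm G R″) F × (∀ t → next R″ t ≡ rot3 x (next R₁ x) z (next R₁ t))) →
            rot3 x (next R₁ x) z (next R₁ a) ≡ t → rot3 x (next R₁ x) z (next R₁ t) ≡ c → Improved
          conclude (R₂ , h₂ , eq) p q =
            R₂ , F , (0 , refl) , h₂ , inj₁ (twice R₂ (trans (eq _) p) (trans (eq _) q))
          cases : Dec (col d ≡ col a) → Dec (col d ≡ col b) → Improved
          -- `a`, its successor `b`, and `d` lie on three faces; moving `a` before `d` gives
          -- `(b a d c)`.
          cases (no d≉a) (no d≉b) = conclude
            (merge-at R₁ h₁ a d d-at (alter refl (cong col a↦₁b) refl (a≉b , d≉a ∘ sym , d≉b ∘ sym)))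
            rot3-y
            (trans (cong (rot3 a (next R₁ a) d) d↦₁c)
              (rot3-other (a≢c ∘ sym) (λ p → c≢b (trans p a↦₁b)) c≢d))
          -- Here `d`, its successor `c`, and `a` lie on three faces; moving `d` before `a` gives
          -- `(a b c d)`.
          cases (no d≉a) (yes d≈b) = conclude
            (merge-at R₁ h₁ d a (sym d-at) (alter d≈b (cong col d↦₁c) refl (c≉b ∘ sym , a≉b ∘ sym , a≉c ∘ sym)))
            (trans (cong (rot3 d (next R₁ d) a) a↦₁b)
              (rot3-other b≢d (λ p → c≢b (sym (trans p d↦₁c))) (a≢b ∘ sym)))
            (trans (cong (rot3 d (next R₁ d) a) b↦₁d)
              (trans (rot3-x (λ p → c≢d (trans (sym d↦₁c) p)) (λ p → a≢c (sym (trans (sym d↦₁c) p)))) d↦₁c))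
          -- No such move at `v` is at hand, so the edge `f` between the far ends of `a` and `c` is
          -- used.
          cases (yes d≈a) _ = faces (col f Fin.≟ col a) (col f Fin.≟ col b)
            where
            keep₁ : next R₁ (next R₁ a) ≡ c ⊎ next R₁ (next R₁ a) ≡ d
            keep₁ = inj₂ (twice R₁ a↦₁b b↦₁d)
            faces : Dec (col f ≡ col a) → Dec (col f ≡ col b) → Improved
            -- `flip G a` lies on the face of `b`, its successor on that of `a`, and `f` on a third
            -- one.
            faces (no f≉a) (no f≉b) = merge-away R₁ h₁ (flip G a) f a-far f-at
              (alter (into a↦₁b) (out a) refl (a≉b ∘ sym , f≉b ∘ sym , f≉a ∘ sym)) keep₁
            -- `flip G c` lies on the face of `a`, its successor on that of `c`. The dart `φ₁ f`
            -- starts at the other end of `f` and lies on the face of `f`, that is, of `b`.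
            faces (no f≉a) (yes f≈b) = merge-away R₁ h₁ (flip G c) (φ₁ f) c-far
              (trans (local R₁ (flip G f)) f-to)
              (alter (into c↦₁a) (out c) (trans (out f) f≈b) (a≉c , a≉b , c≉b)) keep₁
            -- Reversing the rotation at `v` cuts the face of `a` into those of `a` and `d`, and `f`
            -- falls into one of them.
            faces (yes f≈a) _ with exchange a b c d (face-injective R₁) a≢d h₁ (a≉c , a≉b , c≉b) d≈a
            ... | (col₄ , onto₄ , o₄) , (a≉d , a≉₄b , d≉b) , (_ , a≉₄c , d≉c) , halves =
              last (halves f f≈a)
              where
              h₄ : HasOrbits φ₄ (2 + F)
              h₄ = col₄ , onto₄ , orbitMap-cong (λ t → rot3-exchange a≢b a≢c a≢d c≢b b≢d c≢d (facePerm G R t)) o₄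
              module R₄ = Around R₄ h₄
              keep₄ : next R₄ (next R₄ a) ≡ c ⊎ next R₄ (next R₄ a) ≡ d
              keep₄ = inj₂ (twice R₄ a↦₄c c↦₄d)
              last : col₄ f ≡ col₄ a ⊎ col₄ f ≡ col₄ d → Improved
              -- Under `R₄`, `flip G a` lies on the face of `c`, its successor on that of `a`, and
              -- `f` on that of `d`.
              last (inj₂ f≈d) = merge-away R₄ h₄ (flip G a) f a-far f-at
                (R₄.alter (R₄.into a↦₄c) (R₄.out a) f≈d (a≉₄c ∘ sym , d≉c ∘ sym , a≉d)) keep₄
              -- Under `R₄`, `flip G c` lies on the face of `d`, its successor on that of `c`, and
              -- `φ₄ f` on that of `a`.
              last (inj₁ f≈a) = merge-away R₄ h₄ (flip G c) (φ₄ f) c-far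
                (trans (local R₄ (flip G f)) f-to)
                (R₄.alter (R₄.into c↦₄d) (R₄.out c) (trans (R₄.out f) f≈a)
                  (d≉c , a≉d ∘ sym , a≉₄c ∘ sym)) keep₄

      improve : Improved
      improve with toggle3 a c b (face-injective R) a≢c a≢b h
      ... | inj₁ (F₁ , le , h₁) = R₁ , F₁ , le , h₁ , inj₂ (twice R₁ a↦₁b b↦₁d)
      ... | inj₂ (h₁ , D)       = separated h₁ D

recolour : {A C : Set} {f : A → A} {c c′ : A → C} → (∀ a → c a ≡ c′ a) → OrbitMap f c → OrbitMap f c′
recolour eq o a b = mk⇔ (λ p → reach o (trans (eq a) (trans p (sym (eq b)))))
                        (λ r → trans (sym (eq a)) (trans (sameColour o r) (eq b)))

-- The darts of the split graph.

module Splitting (G : Graph) (v : Fin (V G)) (side : Fin (E G) → Bool → Bool) where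

  G* : Graph
  G* = split G v side

  vert* : Dart G* → Fin (suc (V G))
  vert* = vert G*

  sideOf : Dart G → Bool
  sideOf (e , b) = side e b

  old : Dart G → Dart G*
  old (e , b) = suc e , b

  s′ s″ : Dart G*
  s′ = zero , false
  s″ = zero , true

  collapse : Fin (suc (V G)) → Fin (V G)
  collapse zero    = v
  collapse (suc x) = x

  old-injective : ∀ {d d′} → old d ≡ old d′ → d ≡ d′
  old-injective refl = refl

  vert-old : ∀ d → vert* (old d) ≡ splitEnd (V G) v (sideOf d) (vert G d)
  vert-old (e , false) = refl
  vert-old (e , true)  = refl

  old-away : ∀ d → vert G d ≢ v → vert* (old d) ≡ suc (vert G d)
  old-away d n = trans (vert-old d) lem
    where
    lem : splitEnd (V G) v (sideOf d) (vert G d) ≡ suc (vert G d)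
    lem with vert G d Fin.≟ v
    ... | yes p = ⊥-elim (n p)
    ... | no _  = refl

  old-v′ : ∀ d → vert G d ≡ v → sideOf d ≡ false → vert* (old d) ≡ suc v
  old-v′ d p q = trans (vert-old d) lem
    where
    lem : splitEnd (V G) v (sideOf d) (vert G d) ≡ suc v
    lem rewrite q with vert G d Fin.≟ v
    ... | yes _ = cong suc p
    ... | no n  = ⊥-elim (n p)

  old-v″ : ∀ d → vert G d ≡ v → sideOf d ≡ true → vert* (old d) ≡ zero
  old-v″ d p q = trans (vert-old d) lem
    where
    lem : splitEnd (V G) v (sideOf d) (vert G d) ≡ zero
    lem rewrite q with vert G d Fin.≟ v
    ... | yes _ = refl
    ... | no n  = ⊥-elim (n p)

  collapse-old : ∀ d → collapse (vert* (old d)) ≡ vert G d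
  collapse-old d with vert G d Fin.≟ v | sideOf d in eq
  ... | no n  | _     = cong collapse (old-away d n)
  ... | yes p | false = trans (cong collapse (old-v′ d p eq)) (sym p)
  ... | yes p | true  = trans (cong collapse (old-v″ d p eq)) (sym p)

  from-v′ : ∀ d → vert* (old d) ≡ suc v → vert G d ≡ v × sideOf d ≡ false
  from-v′ d p = at , side-false
    where
    at : vert G d ≡ v
    at = trans (sym (collapse-old d)) (cong collapse p)
    side-false : sideOf d ≡ false
    side-false with sideOf d in eq
    ... | false = refl
    ... | true with trans (sym p) (old-v″ d at eq)
    ...   | ()

  from-v″ : ∀ d → vert* (old d) ≡ zero → vert G d ≡ v × sideOf d ≡ true
  from-v″ d p = at , side-true
    where
    at : vert G d ≡ v
    at = trans (sym (collapse-old d)) (cong collapse p)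
    side-true : sideOf d ≡ true
    side-true with sideOf d in eq
    ... | true = refl
    ... | false with trans (sym p) (old-v′ d at eq)
    ...   | ()

  -- `m′` and `m″` are the old darts that stand in for `s′` and `s″`; the choice depends on the
  -- permutation that is followed.
  retract : Dart G → Dart G → Dart G* → Dart G
  retract m′ m″ (zero , false) = m′
  retract m′ m″ (zero , true)  = m″
  retract m′ m″ (suc e , b)    = e , b

  dart-elim : ∀ {P : Dart G* → Set} → P s′ → P s″ → (∀ d → P (old d)) → ∀ u → P u
  dart-elim p q r (zero , false) = p
  dart-elim p q r (zero , true)  = q
  dart-elim p q r (suc e , b)    = r (e , b)

  -- The rotation at v runs once through the darts of v′ and once through those of v″; x and y are the
  -- last darts of these runs.
  record Contiguous (R : Rotation G) : Set where
    field
      x y        : Dart G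
      x-at       : vert G x ≡ v
      y-at       : vert G y ≡ v
      x-side     : sideOf x ≡ false
      x-next     : sideOf (next R x) ≡ true
      y-side     : sideOf y ≡ true
      y-next     : sideOf (next R y) ≡ false
      other-next : ∀ d → vert G d ≡ v → d ≢ x → d ≢ y → sideOf (next R d) ≡ sideOf d

  -- Inserting the splitting-edge into a rotation.

  module Insert (R : Rotation G) (C : Contiguous R) where
    open Contiguous C

    private
      x≢y : x ≢ y
      x≢y p with trans (sym x-side) (trans (cong sideOf p) y-side)
      ... | ()

      ρx≢ρy : next R x ≢ next R y
      ρx≢ρy = x≢y ∘ next-injective R

      prev : Dart G → Dart G
      prev = Inverse.from (ρ R)

      insert : ∀ d → Dec (d ≡ x) → Dec (d ≡ y) → Dart G*
      insert d (yes _) _       = s′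
      insert d (no _)  (yes _) = s″
      insert d (no _)  (no _)  = old (next R d)

      insert⁻¹ : ∀ d → Dec (d ≡ next R x) → Dec (d ≡ next R y) → Dart G*
      insert⁻¹ d (yes _) _       = s″
      insert⁻¹ d (no _)  (yes _) = s′
      insert⁻¹ d (no _)  (no _)  = old (prev d)

      -- `s′` follows `x`, the last dart of the run of `v′`, and leads back to its first dart
      -- `next R y`; `s″` does the same for `v″`.
      to from : Dart G* → Dart G*
      to (zero , false) = old (next R y)
      to (zero , true)  = old (next R x)
      to (suc e , b)    = insert (e , b) ((e , b) ≟ᵈ x) ((e , b) ≟ᵈ y)
      from (zero , false) = old x
      from (zero , true)  = old y
      from (suc e , b)    = insert⁻¹ (e , b) ((e , b) ≟ᵈ next R x) ((e , b) ≟ᵈ next R y)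

      to-x : ∀ {d} → d ≡ x → to (old d) ≡ s′
      to-x {d} p with d ≟ᵈ x
      ... | yes _ = refl
      ... | no n  = ⊥-elim (n p)

      to-y : ∀ {d} → d ≡ y → to (old d) ≡ s″
      to-y {d} p with d ≟ᵈ x | d ≟ᵈ y
      ... | yes q | _     = ⊥-elim (x≢y (trans (sym q) p))
      ... | no _  | yes _ = refl
      ... | no _  | no n  = ⊥-elim (n p)

      to-other : ∀ {d} → d ≢ x → d ≢ y → to (old d) ≡ old (next R d)
      to-other {d} m n with d ≟ᵈ x | d ≟ᵈ y
      ... | yes p | _     = ⊥-elim (m p)
      ... | no _  | yes p = ⊥-elim (n p)
      ... | no _  | no _  = refl

      from-ρx : from (old (next R x)) ≡ s″
      from-ρx with next R x ≟ᵈ next R x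
      ... | yes _ = refl
      ... | no n  = ⊥-elim (n refl)

      from-ρy : from (old (next R y)) ≡ s′
      from-ρy with next R y ≟ᵈ next R x | next R y ≟ᵈ next R y
      ... | yes q | _     = ⊥-elim (ρx≢ρy (sym q))
      ... | no _  | yes _ = refl
      ... | no _  | no n  = ⊥-elim (n refl)

      from-other : ∀ {d} → d ≢ x → d ≢ y → from (old (next R d)) ≡ old d
      from-other {d} m n with next R d ≟ᵈ next R x | next R d ≟ᵈ next R y
      ... | yes p | _     = ⊥-elim (m (next-injective R p))
      ... | no _  | yes p = ⊥-elim (n (next-injective R p))
      ... | no _  | no _  = cong old (Inverse.strictlyInverseʳ (ρ R) d)

      from-to : ∀ u → from (to u) ≡ u
      from-to (zero , false) = from-ρy
      from-to (zero , true)  = from-ρx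
      from-to (suc e , b) = cases ((e , b) ≟ᵈ x) ((e , b) ≟ᵈ y)
        where
        cases : Dec ((e , b) ≡ x) → Dec ((e , b) ≡ y) → from (to (suc e , b)) ≡ (suc e , b)
        cases (yes p) _       = trans (cong from (to-x p)) (cong old (sym p))
        cases (no m)  (yes p) = trans (cong from (to-y p)) (cong old (sym p))
        cases (no m)  (no n)  = trans (cong from (to-other m n)) (from-other m n)

      to-from : ∀ u → to (from u) ≡ u
      to-from (zero , false) = to-x refl
      to-from (zero , true)  = to-y refl
      to-from (suc e , b) = subst (λ d → to (from (old d)) ≡ old d) (Inverse.strictlyInverseˡ (ρ R) (e , b))
                              (cases (prev (e , b) ≟ᵈ x) (prev (e , b) ≟ᵈ y))
        where
        cases : ∀ {d} → Dec (d ≡ x) → Dec (d ≡ y) → to (from (old (next R d))) ≡ old (next R d)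
        cases (yes refl) _        = cong to from-ρx
        cases (no m)   (yes refl) = cong to from-ρy
        cases (no m)   (no n)     = trans (cong to (from-other m n)) (to-other m n)

      onDart : ∀ {P : Dart G → Set} → P x → P y → (∀ {d} → d ≢ x → d ≢ y → P d) → ∀ d → P d
      onDart {P} px py po d with d ≟ᵈ x | d ≟ᵈ y
      ... | yes refl | _        = px
      ... | no _     | yes refl = py
      ... | no m     | no n     = po m n

      -- The rotation of v in G with s″ inserted after x and s′ after y.
      joint : Dart G* → Dart G*
      joint = swap s′ s″ ∘ to

      joint-other : ∀ {u d} → to u ≡ old d → joint u ≡ old d
      joint-other p = trans (cong (swap s′ s″) p) (swap-other (λ ()) (λ ()))

      joint-x : joint (old x) ≡ s″
      joint-x = trans (cong (swap s′ s″) (to-x refl)) (swap-left s′ s″)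

      joint-y : joint (old y) ≡ s′
      joint-y = trans (cong (swap s′ s″) (to-y refl)) (swap-right s′ s″)

      module Joint = FirstReturn {f = joint} {g = next R} old (retract (next R y) (next R x))
        (λ _ → refl)
        (onDart (cong (retract _ _) joint-x) (cong (retract _ _) joint-y)
                (λ m n → cong (retract _ _) (joint-other (to-other m n))))
        (dart-elim
          (inj₂ (cong (retract _ _) (joint-other {s′} refl)))
          (inj₂ (cong (retract _ _) (joint-other {s″} refl)))
          (λ d → inj₁ (d , refl)))
        (dart-elim (reach-≡ (joint-other {s′} refl)) (reach-≡ (joint-other {s″} refl)) (λ _ → reach-refl))

      joint-orbits : OrbitMap joint (vert G ∘ retract (next R y) (next R x))
      joint-orbits = Joint.up (dart-elim
        (y , reach-≡ joint-y)
        (x , reach-≡ joint-x)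
        (λ d → d , reach-refl)) (next-orbits R)

      collapse-retract : ∀ u → collapse (vert* u) ≡ vert G (retract (next R y) (next R x) u)
      collapse-retract (zero , false) = sym (trans (local R y) y-at)
      collapse-retract (zero , true)  = sym (trans (local R x) x-at)
      collapse-retract (suc e , b)    = collapse-old (e , b)

      to-local : ∀ u → vert* (to u) ≡ vert* u
      to-local (zero , false) = old-v′ _ (trans (local R y) y-at) y-next
      to-local (zero , true)  = old-v″ _ (trans (local R x) x-at) x-next
      to-local (suc e , b) = onDart {P = λ d → vert* (to (old d)) ≡ vert* (old d)}
        (trans (cong vert* (to-x refl)) (sym (old-v′ x x-at x-side)))
        (trans (cong vert* (to-y refl)) (sym (old-v″ y y-at y-side)))
        (λ {d} m n → trans (cong vert* (to-other m n)) (rest d m n)) (e , b)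
        where
        rest : ∀ d → d ≢ x → d ≢ y → vert* (old (next R d)) ≡ vert* (old d)
        rest d m n with vert G d Fin.≟ v
        ... | no far = trans (old-away (next R d) (λ p → far (trans (sym (local R d)) p)))
                         (trans (cong suc (local R d)) (sym (old-away d far)))
        ... | yes at = trans (vert-old (next R d)) (trans (cong₂ (splitEnd (V G) v) (other-next d at m n) (local R d))
                         (sym (vert-old d)))

    inserted : Rotation G*
    inserted = mkRotation (mk↔ₛ′ to from to-from from-to)
      -- In `joint` the two new vertices still form one orbit; the transposition of `s′` and `s″`
      -- separates them.
      (split-orbits (swap-untoggles s′ s″ to) joint-orbits vert* to-local
        (λ {u} {w} p → trans (sym (collapse-retract u)) (trans (cong collapse p) (collapse-retract w)))
        (λ ()))

    private
      to-flip : ∀ {d u} → to (old d) ≡ u → facePerm G* inserted (old (flip G d)) ≡ u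
      to-flip {d} p = trans (cong (to ∘ old) (flip-flip {G} d)) p

      onFlip : ∀ {P : Dart G → Set} → (∀ d → P (flip G d)) → ∀ d → P d
      onFlip {P} h d = subst P (flip-flip {G} d) (h (flip G d))

      φ-flip : ∀ d → facePerm G R (flip G d) ≡ next R d
      φ-flip d = cong (next R) (flip-flip {G} d)

      module Faces = FirstReturn {f = facePerm G* inserted} {g = facePerm G R} old (retract (next R x) (next R y))
        (λ _ → refl)
        (onFlip (onDart
          (trans (cong (retract _ _) (to-flip (to-x refl))) (sym (φ-flip x)))
          (trans (cong (retract _ _) (to-flip (to-y refl))) (sym (φ-flip y)))
          (λ {d} m n → trans (cong (retract _ _) (to-flip (to-other m n))) (sym (φ-flip d)))))
        (dart-elim (inj₂ refl) (inj₂ refl) (λ d → inj₁ (d , refl)))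
        (dart-elim reach-step reach-step (λ _ → reach-refl))

    -- The face step from `flip G x` to `next R x` now passes through `s′`, and the one from
    -- `flip G y` to `next R y` through `s″`; all others are unchanged.
    inserted-faces : ∀ {F} → HasOrbits (facePerm G R) F → HasOrbits (facePerm G* inserted) F
    inserted-faces = Faces.up-count (dart-elim
        (flip G x , reach-≡ (to-flip (to-x refl)))
        (flip G y , reach-≡ (to-flip (to-y refl)))
        (λ d → d , reach-refl))

  -- Contracting the splitting-edge.

  module Contract (R : Rotation G*) (p q : Dart G)
                  (p-at : vert* (old p) ≡ suc v) (q-at : vert* (old q) ≡ zero) where

    private
      to from : Dart G* → Dart G*
      to   = Inverse.to (ρ R)
      from = Inverse.from (ρ R)

      to-from : ∀ u → to (from u) ≡ u
      to-from = Inverse.strictlyInverseˡ (ρ R)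

      from-to : ∀ u → from (to u) ≡ u
      from-to = Inverse.strictlyInverseʳ (ρ R)

      fixed : ∀ {u} → to u ≡ u → ∀ {w} → Reach to u w → w ≡ u
      fixed p (zero  , q) = sym q
      fixed p (suc k , q) = trans (sym q) (trans (cong to (fixed p (k , refl))) p)

      -- A fixed `s′` would be alone at `v′`, where `old p` is another dart.
      moved′ : to s′ ≢ s′
      moved′ e with fixed e (cyclic R s′ (old p) (sym p-at))
      ... | ()

      moved″ : to s″ ≢ s″
      moved″ e with fixed e (cyclic R s″ (old q) (sym q-at))
      ... | ()

      is-old : ∀ u → u ≢ s′ → u ≢ s″ → ∃ λ d → u ≡ old d
      is-old (zero , false) m n = ⊥-elim (m refl)
      is-old (zero , true)  m n = ⊥-elim (n refl)
      is-old (suc e , b)    m n = (e , b) , refl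

      s′≁s″ : ∀ {u w} → to u ≡ w → vert* u ≢ vert* w → ⊥
      s′≁s″ {u} e n = n (trans (sym (local R u)) (cong vert* e))

      after′ : ∃ λ d → to s′ ≡ old d
      after′ = is-old (to s′) moved′ (λ e → s′≁s″ e (λ ()))

      after″ : ∃ λ d → to s″ ≡ old d
      after″ = is-old (to s″) (λ e → s′≁s″ e (λ ())) moved″

      before′ : ∃ λ d → from s′ ≡ old d
      before′ = is-old (from s′) (λ e → moved′ (trans (cong to (sym e)) (to-from s′)))
        (λ e → s′≁s″ (trans (cong to (sym e)) (to-from s′)) (λ ()))

      before″ : ∃ λ d → from s″ ≡ old d
      before″ = is-old (from s″) (λ e → s′≁s″ (trans (cong to (sym e)) (to-from s″)) (λ ()))
        (λ e → moved″ (trans (cong to (sym e)) (to-from s″)))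

      -- On meeting `s′` the rotation of the contracted vertex goes on behind `s″`, and conversely;
      -- hence the crossed arguments. `skip⁻` serves the inverse.
      skip⁺ skip⁻ : Dart G* → Dart G
      skip⁺ = retract (proj₁ after″) (proj₁ after′)
      skip⁻ = retract (proj₁ before″) (proj₁ before′)

      to-before : ∀ {s d} → from s ≡ old d → to (old d) ≡ s
      to-before {s} e = trans (cong to (sym e)) (to-from s)

      from-after : ∀ {s d} → to s ≡ old d → from (old d) ≡ s
      from-after {s} e = trans (cong from (sym e)) (from-to s)

      contract-to-from : ∀ d → skip⁺ (to (old (skip⁻ (from (old d))))) ≡ d
      contract-to-from d with from (old d) in eq
      ... | zero , false = trans (cong skip⁺ (to-before (proj₂ before″)))
        (old-injective (trans (sym (proj₂ after′)) (trans (cong to (sym eq)) (to-from _))))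
      ... | zero , true  = trans (cong skip⁺ (to-before (proj₂ before′)))
        (old-injective (trans (sym (proj₂ after″)) (trans (cong to (sym eq)) (to-from _))))
      ... | suc e , b    = cong skip⁺ {y = old d} (trans (cong to (sym eq)) (to-from (old d)))

      contract-from-to : ∀ d → skip⁻ (from (old (skip⁺ (to (old d))))) ≡ d
      contract-from-to d with to (old d) in eq
      ... | zero , false = trans (cong skip⁻ (from-after (proj₂ after″)))
        (old-injective (trans (sym (proj₂ before′)) (trans (cong from (sym eq)) (from-to _))))
      ... | zero , true  = trans (cong skip⁻ (from-after (proj₂ after′)))
        (old-injective (trans (sym (proj₂ before″)) (trans (cong from (sym eq)) (from-to _))))
      ... | suc e , b    = cong skip⁻ {y = old d} (trans (cong from (sym eq)) (from-to (old d)))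

      joint : Dart G* → Dart G*
      joint = swap s′ s″ ∘ to

      joint-other : ∀ {u d} → to u ≡ old d → joint u ≡ old d
      joint-other p = trans (cong (swap s′ s″) p) (swap-other (λ ()) (λ ()))

      retract-joint : ∀ u → retract (proj₁ after′) (proj₁ after″) (swap s′ s″ u) ≡ skip⁺ u
      retract-joint (zero , false) = cong (retract _ _) (swap-left s′ s″)
      retract-joint (zero , true)  = cong (retract _ _) (swap-right s′ s″)
      retract-joint (suc e , b)    = cong (retract _ _) (swap-other (λ ()) (λ ()))

      module Joint = FirstReturn {f = joint} {g = skip⁺ ∘ to ∘ old} old (retract (proj₁ after′) (proj₁ after″))
        (λ _ → refl) (λ d → retract-joint (to (old d)))
        (dart-elim
          (inj₂ (cong (retract _ _) (joint-other (proj₂ after′))))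
          (inj₂ (cong (retract _ _) (joint-other (proj₂ after″))))
          (λ d → inj₁ (d , refl)))
        (dart-elim
          (reach-≡ (joint-other (proj₂ after′)))
          (reach-≡ (joint-other (proj₂ after″)))
          (λ _ → reach-refl))

      joined : ∀ {u w} → collapse (vert* u) ≡ collapse (vert* w) → Joined vert* s′ s″ u w
      joined {u} {w} e = go (vert* u) (vert* w) e
        where
        go : ∀ i j → collapse i ≡ collapse j →
             i ≡ j ⊎ ((i ≡ suc v ⊎ i ≡ zero) × (j ≡ suc v ⊎ j ≡ zero))
        go zero    zero    e = inj₁ refl
        go zero    (suc j) e = inj₂ (inj₂ refl , inj₁ (cong suc (sym e)))
        go (suc i) zero    e = inj₂ (inj₁ (cong suc e) , inj₂ refl)
        go (suc i) (suc j) e = inj₁ (cong suc e)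

    contracted : Rotation G
    contracted = mkRotation
      (mk↔ₛ′ (skip⁺ ∘ to ∘ old) (skip⁻ ∘ from ∘ old) contract-to-from contract-from-to)
      (recolour collapse-old (Joint.down
        -- The transposition of `s′` and `s″` joins the orbits of `v′` and `v″`; the first return to
        -- the old darts then drops both new darts.
        (merge-orbits (swap-toggles s′ s″ to) (next-orbits R) (collapse ∘ vert*)
          (λ ()) (cong collapse) refl (λ {u} {w} → joined {u} {w}))))

    private
      module Faces = FirstReturn {f = facePerm G* R} {g = facePerm G contracted} old skip⁺
        (λ _ → refl) (λ _ → refl)
        (dart-elim
          (inj₂ (cong skip⁺ (proj₂ after″)))
          (inj₂ (cong skip⁺ (proj₂ after′)))
          (λ d → inj₁ (d , refl)))
        (dart-elim (reach-≡ (proj₂ after″)) (reach-≡ (proj₂ after′)) (λ _ → reach-refl))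

    -- On a face, `s′` is followed by the dart after `s″`, which is its image under `skip⁺`. So `s′`
    -- and `s″` are merely deleted from the face walks, and each face keeps an old dart.
    contracted-faces : ∀ {F} → HasOrbits (facePerm G* R) F → HasOrbits (facePerm G contracted) F
    contracted-faces = Faces.down-count

-- Enumerating the darts at a vertex; rotations at a vertex of degree four.

lookup-injective : {A : Set} {xs : List A} → Unique xs → ∀ {i j} → lookup xs i ≡ lookup xs j → i ≡ j
lookup-injective (_ ∷ _)  {zero}  {zero}  p = refl
lookup-injective (n ∷ _)  {zero}  {suc j} p = ⊥-elim (All.lookup n (∈-lookup j) p)
lookup-injective (n ∷ _)  {suc i} {zero}  p = ⊥-elim (All.lookup n (∈-lookup i) (sym p))
lookup-injective (_ ∷ us) {suc i} {suc j} p = cong suc (lookup-injective us p)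

module _ (G : Graph) (v : Fin (V G)) where

  private
    bools : List Bool
    bools = false ∷ true ∷ []

    at? : ∀ d → Dec (vert G d ≡ v)
    at? d = vert G d Fin.≟ v

    darts : List (Fin (E G)) → List (Dart G)
    darts es = filter at? (cartesianProduct es bools)

    length-darts : ∀ es → length (darts es) ≡ sum (map (endsAt G v) es)
    length-darts []       = refl
    length-darts (e ∷ es) with proj₁ (ends G e) Fin.≟ v
    length-darts (e ∷ es) | yes _ with proj₂ (ends G e) Fin.≟ v
    ... | yes _ = cong (2 +_) (length-darts es)
    ... | no _  = cong suc (length-darts es)
    length-darts (e ∷ es) | no _ with proj₂ (ends G e) Fin.≟ v
    ... | yes _ = cong suc (length-darts es)
    ... | no _  = length-darts es

    unique-bools : Unique bools
    unique-bools = ((λ ()) ∷ []) ∷ [] ∷ []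

    ∈-bools : ∀ b → b ∈ bools
    ∈-bools false = here refl
    ∈-bools true  = there (here refl)

  record Enumeration (n : ℕ) : Set where
    field
      enum     : Fin n → Dart G
      enum-inj : ∀ {i j} → enum i ≡ enum j → i ≡ j
      enum-at  : ∀ i → vert G (enum i) ≡ v
      index    : ∀ d → vert G d ≡ v → ∃ λ i → enum i ≡ d

  enumerate : Enumeration (deg G v)
  enumerate = subst Enumeration (length-darts (allFin (E G))) record
    { enum     = lookup (darts (allFin (E G)))
    ; enum-inj = lookup-injective (filter⁺ at? (cartesianProduct⁺ (allFin⁺ (E G)) unique-bools))
    ; enum-at  = λ i → proj₂ (∈-filter⁻ at? {xs = cartesianProduct (allFin (E G)) bools} (∈-lookup i))
    ; index    = λ (e , b) p → let m = ∈-filter⁺ at? (∈-cartesianProduct⁺ (∈-allFin e) (∈-bools b)) p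
                               in Any.index m , sym (lookup-index m)
    }

iter-injective : {A : Set} {f : A → A} → (∀ {a b} → f a ≡ f b → a ≡ b) →
                 ∀ k {a b} → iter f k a ≡ iter f k b → a ≡ b
iter-injective inj zero    p = p
iter-injective inj (suc k) p = iter-injective inj k (inj p)

iter-wrap : {A : Set} {f : A → A} {a : A} (j : ℕ) → iter f (suc j) a ≡ a →
            ∀ k → ∃ λ i → i < suc j × iter f i a ≡ iter f k a
iter-wrap j p zero = 0 , s≤s z≤n , refl
iter-wrap {f = f} j p (suc k) with iter-wrap j p k
... | i , s≤s i≤j , q with m≤n⇒m<n∨m≡n i≤j
... | inj₁ i<j  = suc i , s≤s i<j , cong f q
... | inj₂ refl = 0 , s≤s z≤n , trans (sym p) (cong f q)

module FourDarts {G : Graph} {v : Fin (V G)} (deg≡4 : deg G v ≡ 4)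
                 (R : Rotation G) (a : Dart G) (a-at : vert G a ≡ v) where

  private
    open Enumeration (subst (Enumeration G v) deg≡4 (enumerate G v))

    σ : Dart G → Dart G
    σ = next R

    iter-at : ∀ k → vert G (iter σ k a) ≡ v
    iter-at k = trans (sym (invariant-reach (local R) (k , refl))) a-at

  -- An early return would leave fewer than four iterates to account for the four enumerated darts.
  no-return : ∀ j → suc j < 4 → iter σ (suc j) a ≢ a
  no-return j j<4 p = Fin.<⇒≢ (proj₁ (proj₂ (proj₂ clash))) (enum-inj same)
    where
    step# : ∀ t → ∃ λ i → i < suc j × iter σ i a ≡ enum t
    step# t with cyclic R a (enum t) (trans a-at (sym (enum-at t)))
    ... | k , q with iter-wrap j p k
    ... | i , i<j , r = i , i<j , trans r q
    clash = Fin.pigeonhole j<4 (λ t → fromℕ< (proj₁ (proj₂ (step# t))))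
    same : enum (proj₁ clash) ≡ enum (proj₁ (proj₂ clash))
    same with clash
    ... | t , t′ , _ , e =
      trans (sym (proj₂ (proj₂ (step# t))))
      (trans (cong (λ i → iter σ i a)
        (trans (sym (Fin.toℕ-fromℕ< _)) (trans (cong toℕ e) (Fin.toℕ-fromℕ< _))))
      (proj₂ (proj₂ (step# t′))))

  -- Two of the five iterates with exponents 0 to 4 coincide; their difference is a return time of
  -- at most 4, and `no-return` leaves only 4.
  closes : iter σ 4 a ≡ a
  closes with Fin.pigeonhole (n<1+n 4) (λ i → proj₁ (index (iter σ (toℕ i) a) (iter-at (toℕ i))))
  ... | i , j , i<j , e = go (toℕ j ∸ toℕ i) (m<n⇒0<n∸m i<j)
                             (≤-trans (m∸n≤m (toℕ j) (toℕ i)) (≤-pred (Fin.toℕ<n j))) returns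
    where
    same : iter σ (toℕ i) a ≡ iter σ (toℕ j) a
    same = trans (sym (proj₂ (index _ (iter-at (toℕ i)))))
             (trans (cong enum e) (proj₂ (index _ (iter-at (toℕ j)))))
    returns : iter σ (toℕ j ∸ toℕ i) a ≡ a
    returns = iter-injective (next-injective R) (toℕ i) (trans (sym (iter-+ (toℕ i) (toℕ j ∸ toℕ i) a))
      (trans (cong (λ m → iter σ m a) (trans (+-comm (toℕ i) _) (m∸n+n≡m (<⇒≤ i<j)))) (sym same)))
    go : ∀ k → 0 < k → k ≤ 4 → iter σ k a ≡ a → iter σ 4 a ≡ a
    go (suc k) _ k≤4 p with m≤n⇒m<n∨m≡n k≤4
    ... | inj₁ k<4 = ⊥-elim (no-return k k<4 p)
    ... | inj₂ k≡4 = trans (cong (λ m → iter σ m a) (sym k≡4)) p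

  complete : ∀ {P : Dart G → Set} → P a → P (σ a) → P (σ (σ a)) → P (σ (σ (σ a))) →
             ∀ d → vert G d ≡ v → P d
  complete {P} p₀ p₁ p₂ p₃ d d-at with cyclic R a d (trans a-at (sym d-at))
  ... | k , q with iter-wrap 3 closes k
  ... | i , i<4 , r = subst P (trans r q) (go i i<4)
    where
    go : ∀ i → i < 4 → P (iter σ i a)
    go 0 _ = p₀
    go 1 _ = p₁
    go 2 _ = p₂
    go 3 _ = p₃
    go (suc (suc (suc (suc _)))) (s≤s (s≤s (s≤s (s≤s ()))))

-- Conjugating a rotation by an automorphism that fixes every vertex.

module Conjugate {G : Graph} (R : Rotation G) (θ : Dart G → Dart G) (θθ : ∀ d → θ (θ d) ≡ d)
  (θ-vert : ∀ d → vert G (θ d) ≡ vert G d) (θ-flip : ∀ d → θ (flip G d) ≡ flip G (θ d)) where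

  iter-conjugate : ∀ (f : Dart G → Dart G) k d → iter (θ ∘ f ∘ θ) k d ≡ θ (iter f k (θ d))
  iter-conjugate f zero    d = sym (θθ d)
  iter-conjugate f (suc k) d = cong (θ ∘ f) (trans (cong θ (iter-conjugate f k d)) (θθ _))

  orbits-conjugate : ∀ {C : Set} {f : Dart G → Dart G} {c : Dart G → C} →
                     OrbitMap f c → OrbitMap (θ ∘ f ∘ θ) (c ∘ θ)
  orbits-conjugate {f = f} o a b = mk⇔
    (λ p → let k , q = reach o p in k , trans (iter-conjugate f k a) (trans (cong θ q) (θθ b)))
    (λ (k , q) → sameColour o (k , trans (sym (θθ _)) (cong θ (trans (sym (iter-conjugate f k a)) q))))

  conjugate : Rotation G
  conjugate = mkRotation
    (mk↔ₛ′ (θ ∘ next R ∘ θ) (θ ∘ Inverse.from (ρ R) ∘ θ)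
      (λ d → trans (cong (θ ∘ next R) (θθ _)) (trans (cong θ (Inverse.strictlyInverseˡ (ρ R) (θ d))) (θθ d)))
      (λ d → trans (cong (θ ∘ Inverse.from (ρ R)) (θθ _))
               (trans (cong θ (Inverse.strictlyInverseʳ (ρ R) (θ d))) (θθ d))))
    (recolour θ-vert (orbits-conjugate (next-orbits R)))

  -- As `θ` commutes with `flip`, the face permutation is conjugated along with the rotation.
  conjugate-faces : ∀ {F} → HasOrbits (facePerm G R) F → HasOrbits (facePerm G conjugate) F
  conjugate-faces (c , onto , o) = c ∘ θ
    , (λ i → let d , p = onto i in θ d , trans (cong c (θθ d)) p)
    , orbitMap-cong (λ d → cong (θ ∘ next R) (sym (θ-flip d))) (orbits-conjugate o)

  next² : ∀ d → next conjugate (next conjugate d) ≡ θ (next R (next R (θ d)))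
  next² d = cong (θ ∘ next R) (θθ _)

module _ {G : Graph} where

  -- Conjugate by the automorphism that reverses the loop or exchanges the two parallel edges. It
  -- takes `p` to `q` and fixes the dart two places after `q`, which differs from `p` and `q`.
  parallel-swap : ∀ (R : Rotation G) {F} (p q : Dart G) → vert G p ≡ vert G q →
    (q ≡ flip G p ⊎ (vert G (flip G p) ≢ vert G p × vert G (flip G p) ≡ vert G (flip G q))) →
    next R (next R q) ≢ p → next R (next R q) ≢ q → HasOrbits (facePerm G R) F →
    ∃ λ R′ → HasOrbits (facePerm G R′) F × next R′ (next R′ p) ≡ next R (next R q)
  parallel-swap R p q pq (inj₁ loop) m n h =
    conjugate , conjugate-faces h ,
    trans (next² p) (trans (cong (θ ∘ next R ∘ next R) (swap-left p q)) (swap-other m n))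
    where
    θ : Dart G → Dart G
    θ = swap p q
    open Conjugate R θ (swap-involutive p q) (swap-invariant {c = vert G} pq)
      (λ d → sym (trans (swap-natural (flip G) (flip-injective {G}) p q d)
        (trans (cong₂ (λ s t → swap s t (flip G d)) (sym loop) (trans (cong (flip G) loop) (flip-flip {G} p)))
               (swap-sym q p (flip G d)))))
  parallel-swap R p q pq (inj₂ (far , p′q′)) m n h =
    conjugate , conjugate-faces h ,
    trans (next² p) (trans (cong (θ ∘ next R ∘ next R) θp)
      (trans (cong (swap p q) (swap-other (near₂ far′) (near₂ far″))) (swap-other m n)))
    where
    p′ q′ : Dart G
    p′ = flip G p
    q′ = flip G q
    θ : Dart G → Dart G
    θ d = swap p q (swap p′ q′ d)
    far′ : vert G p′ ≢ vert G p
    far′ = far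
    far″ : vert G q′ ≢ vert G p
    far″ e = far (trans p′q′ e)
    near : ∀ {s t} → vert G s ≡ vert G p → vert G t ≢ vert G p → s ≢ t
    near e f refl = f e
    near₂ : ∀ {t} → vert G t ≢ vert G p → next R (next R q) ≢ t
    near₂ = near (trans (local R _) (trans (local R q) (sym pq)))
    θp : θ p ≡ q
    θp = trans (cong (swap p q) (swap-other (near refl far′) (near refl far″))) (swap-left p q)
    commute : ∀ d → swap p′ q′ (swap p q d) ≡ swap p q (swap p′ q′ d)
    commute d = trans (swap-natural (swap p′ q′) (swap-injective p′ q′) p q d)
      (cong₂ (λ s t → swap s t (swap p′ q′ d))
        (swap-other (near refl far′) (near refl far″))
        (swap-other (near (sym pq) far′) (near (sym pq) far″)))
    open Conjugate R θ
      (λ d → trans (cong (swap p q) (commute (swap p′ q′ d)))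
        (trans (swap-involutive p q _) (swap-involutive p′ q′ d)))
      (λ d → trans (swap-invariant {c = vert G} pq _) (swap-invariant {c = vert G} p′q′ d))
      (λ d → sym (trans (swap-natural (flip G) (flip-injective {G}) p q (swap p′ q′ d))
        (trans (cong (swap p′ q′) (trans (swap-natural (flip G) (flip-injective {G}) p′ q′ d)
                 (cong₂ (λ s t → swap s t (flip G d)) (flip-flip {G} p) (flip-flip {G} q))))
               (commute (flip G d)))))

-- A short cycle through the splitting-edge.

module ShortCycle (G : Graph) (v : Fin (V G)) (side : Fin (E G) → Bool → Bool) where
  open Splitting G v side

  -- The other edges of a cycle of length 2, 3 or 4 through the splitting-edge of G*, where p is a dart
  -- at v′ and q a dart at v″.
  data Link (p q : Dart G) : Set where
    loop     : q ≡ flip G p → Link p q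
    parallel : vert G (flip G p) ≢ v → vert G (flip G p) ≡ vert G (flip G q) → Link p q
    via      : vert G (flip G p) ≢ v → vert G (flip G q) ≢ v → (f : Dart G) →
               vert G f ≡ vert G (flip G p) → vert G (flip G f) ≡ vert G (flip G q) → Link p q

  record Linked : Set where
    constructor linked
    field
      p q    : Dart G
      p-at   : vert G p ≡ v
      q-at   : vert G q ≡ v
      p-side : sideOf p ≡ false
      q-side : sideOf q ≡ true
      link   : Link p q

  private
    Near : Bool → Fin (suc (V G)) → Set
    Near s x = ∃ λ p → vert G p ≡ v × sideOf p ≡ s × vert G (flip G p) ≢ v × x ≡ suc (vert G (flip G p))

    -- The two vertices with their neighbours outside the splitting-edge. Together these sets cover
    -- the splitting subgraph; they may overlap.
    Left Right : Fin (suc (V G)) → Set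
    Left  x = x ≡ suc v ⊎ Near false x
    Right x = x ≡ zero ⊎ Near true x

    joins-dart : ∀ {e x y} → Joins G* (suc e) x y →
                 ∃ λ d → vert* (old d) ≡ x × vert* (old (flip G d)) ≡ y
    joins-dart {e} (inj₁ p) = (e , false) , cong proj₁ p , cong proj₂ p
    joins-dart {e} (inj₂ p) = (e , true) , cong proj₂ p , cong proj₁ p

    neighbour : ∀ s d {x} → vert G d ≡ v → sideOf d ≡ s → vert* (old (flip G d)) ≡ x →
                x ≡ suc v ⊎ x ≡ zero ⊎ Near s x
    neighbour s d at on p with vert G (flip G d) Fin.≟ v | sideOf (flip G d) in eq
    ... | no far  | _     = inj₂ (inj₂ (d , at , on , far , trans (sym p) (old-away (flip G d) far)))
    ... | yes at′ | false = inj₁ (trans (sym p) (old-v′ (flip G d) at′ eq))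
    ... | yes at′ | true  = inj₂ (inj₁ (trans (sym p) (old-v″ (flip G d) at′ eq)))

    covered : ∀ {x} → InSpl G v side x → Left x ⊎ Right x
    covered (inj₁ p)        = inj₁ (inj₁ p)
    covered (inj₂ (inj₁ p)) = inj₂ (inj₁ p)
    covered (inj₂ (inj₂ (inj₁ (zero , inj₁ p)))) = inj₂ (inj₁ (sym (cong proj₂ p)))
    covered (inj₂ (inj₂ (inj₁ (zero , inj₂ ()))))
    covered (inj₂ (inj₂ (inj₁ (suc e , j)))) with joins-dart j
    ... | d , p , q with from-v′ d p
    ... | at , on with neighbour false d at on q
    ... | inj₁ r        = inj₁ (inj₁ r)
    ... | inj₂ (inj₁ r) = inj₂ (inj₁ r)
    ... | inj₂ (inj₂ r) = inj₁ (inj₂ r)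
    covered (inj₂ (inj₂ (inj₂ (zero , inj₁ ()))))
    covered (inj₂ (inj₂ (inj₂ (zero , inj₂ p)))) = inj₁ (inj₁ (sym (cong proj₁ p)))
    covered (inj₂ (inj₂ (inj₂ (suc e , j)))) with joins-dart j
    ... | d , p , q with from-v″ d p
    ... | at , on with neighbour true d at on q
    ... | inj₁ r        = inj₁ (inj₁ r)
    ... | inj₂ (inj₁ r) = inj₂ (inj₁ r)
    ... | inj₂ (inj₂ r) = inj₂ (inj₂ r)

    collapsed : ∀ d {x} → vert* (old d) ≡ suc x → vert G d ≡ x
    collapsed d p = trans (sym (collapse-old d)) (cong collapse p)

    -- With the splitting-edge, the edge of `d` closes a cycle of length 2, 3, 3 or 4, according to
    -- whether its ends are `v′` and `v″` themselves or neighbours of them.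
    bridge : ∀ d {x y} → vert* (old d) ≡ x → vert* (old (flip G d)) ≡ y → Left x → Right y → Linked
    bridge d p q (inj₁ r) (inj₁ s) =
      let at , on = from-v′ d (trans p r) ; at′ , on′ = from-v″ (flip G d) (trans q s)
      in linked d (flip G d) at at′ on on′ (loop refl)
    bridge d p q (inj₁ r) (inj₂ (t , t-at , t-on , far , s)) =
      let at , on = from-v′ d (trans p r) ; eq = collapsed (flip G d) (trans q s)
      in linked d t at t-at on t-on (parallel (far ∘ trans (sym eq)) eq)
    bridge d p q (inj₂ (t , t-at , t-on , far , r)) (inj₁ s) =
      let at , on = from-v″ (flip G d) (trans q s)
      in linked t (flip G d) t-at at t-on on
           (parallel far (sym (trans (cong (vert G) (flip-flip {G} d)) (collapsed d (trans p r)))))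
    bridge d p q (inj₂ (t , t-at , t-on , far , r)) (inj₂ (u , u-at , u-on , far′ , s)) =
      linked t u t-at u-at t-on u-on
        (via far far′ d (collapsed d (trans p r)) (collapsed (flip G d) (trans q s)))

    inSpl : ∀ {e x y} → SplEdgeNotSplitting G v side (suc e) → Joins G* (suc e) x y → InSpl G v side y
    inSpl (_ , i) (inj₁ p) = subst (InSpl G v side) (cong proj₂ p) i
    inSpl (i , _) (inj₂ p) = subst (InSpl G v side) (cong proj₁ p) i

    -- The walk starts in `Left`, and a step that leaves `Left` arrives in `Right`, so its edge is a
    -- bridge. As `v″` is not in `Left`, a walk to `v″` contains such a step.
    follow : ∀ {x} → Walk G* (SplEdgeNotSplitting G v side) (suc v) x → Linked ⊎ Left x
    follow here = inj₂ (inj₁ refl)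
    follow (step zero () j w)
    follow (step (suc e) ok j w) with follow w
    ... | inj₁ l = inj₁ l
    ... | inj₂ left with covered (inSpl ok j)
    ... | inj₁ l = inj₂ l
    ... | inj₂ r with joins-dart j
    ... | d , p , q = inj₁ (bridge d p q left r)

  shortCycle : SplitEdgeNotCut G v side → Linked
  shortCycle w with follow w
  ... | inj₁ l                              = l
  ... | inj₂ (inj₁ ())
  ... | inj₂ (inj₂ (_ , _ , _ , _ , ()))

  -- Contraction lowers the numbers of vertices and edges by one each and keeps the faces, so
  -- Euler's formula gives the same genus.
  contract-genus : Linked → ∀ R* g → EmbGenus G* R* g → ∃ λ R → EmbGenus G R g
  contract-genus (linked p q p-at q-at p-side q-side _) R* g (F , h , euler) =
    contracted , F , contracted-faces h , suc-injective euler
    where open Contract R* p q (old-v′ p p-at p-side) (old-v″ q q-at q-side)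

-- Comparing genera and upper embeddability.

euler-drop : ∀ {A B F F′ g j} → A + F + 2 * g ≡ B → F ≡ 2 * j + F′ → A + F′ + 2 * (g + j) ≡ B
euler-drop {A} {B} {F} {F′} {g} {j} p refl = trans
  (solve 4 (λ a f g j → a :+ f :+ con 2 :* (g :+ j) := a :+ (con 2 :* j :+ f) :+ con 2 :* g) refl A F′ g j) p
  where open +-*-Solver

module _ (G : Graph) (v : Fin (V G)) (deg≡4 : deg G v ≡ 4) (side : Fin (E G) → Bool → Bool) where
  open Splitting G v side
  open ShortCycle G v side

  private
    Alternating : Rotation G → Set
    Alternating R = ∀ d → vert G d ≡ v → sideOf (next R d) ≡ not (sideOf d)

    transition : (R : Rotation G) → ∀ k d → sideOf d ≡ false → sideOf (iter (next R) k d) ≡ true →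
                 ∃ λ i → sideOf (iter (next R) i d) ≡ false × sideOf (iter (next R) (suc i) d) ≡ true
    transition R zero d p q with trans (sym p) q
    ... | ()
    transition R (suc k) d p q with sideOf (iter (next R) k d) in eq
    ... | false = k , eq , q
    ... | true  = transition R k d p eq

    -- Start at a dart `t` on side `false` whose successor is on side `true`. Of the four
    -- possibilities for the other two darts, only `false`, `true` alternates.
    classify : (R : Rotation G) → Linked → Contiguous R ⊎ Alternating R
    classify R (linked p q p-at q-at p-side q-side _)
      with cyclic R p q (trans p-at (sym q-at))
    ... | k , r with transition R k p p-side (trans (cong sideOf r) q-side)
    ... | i , t-side , σt-side = result
      where
      σ : Dart G → Dart G
      σ = next R
      t : Dart G
      t = iter σ i p
      t-at : vert G t ≡ v
      t-at = trans (sym (invariant-reach (local R) (i , refl))) p-at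
      at₁ : vert G (σ t) ≡ v
      at₁ = trans (local R _) t-at
      at₂ : vert G (σ (σ t)) ≡ v
      at₂ = trans (local R _) at₁
      at₃ : vert G (σ (σ (σ t))) ≡ v
      at₃ = trans (local R _) at₂
      open FourDarts deg≡4 R t t-at
      last-side : sideOf (σ (σ (σ (σ t)))) ≡ false
      last-side = trans (cong sideOf closes) t-side
      result : Contiguous R ⊎ Alternating R
      result with sideOf (σ (σ t)) in e₂ | sideOf (σ (σ (σ t))) in e₃
      ... | false | true = inj₂ (complete
        (trans σt-side (cong not (sym t-side))) (trans e₂ (cong not (sym σt-side)))
        (trans e₃ (cong not (sym e₂))) (trans last-side (cong not (sym e₃))))
      ... | false | false = inj₁ record
        { x = t ; y = σ t ; x-at = t-at ; y-at = at₁ ; x-side = t-side ; x-next = σt-side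
        ; y-side = σt-side ; y-next = e₂
        ; other-next = complete (λ m _ → ⊥-elim (m refl)) (λ _ n → ⊥-elim (n refl))
            (λ _ _ → trans e₃ (sym e₂)) (λ _ _ → trans last-side (sym e₃)) }
      ... | true | false = inj₁ record
        { x = t ; y = σ (σ t) ; x-at = t-at ; y-at = at₂ ; x-side = t-side ; x-next = σt-side
        ; y-side = e₂ ; y-next = e₃
        ; other-next = complete (λ m _ → ⊥-elim (m refl)) (λ _ _ → trans e₂ (sym σt-side))
            (λ _ n → ⊥-elim (n refl)) (λ _ _ → trans last-side (sym e₃)) }
      ... | true | true = inj₁ record
        { x = t ; y = σ (σ (σ t)) ; x-at = t-at ; y-at = at₃ ; x-side = t-side ; x-next = σt-side
        ; y-side = e₃ ; y-next = last-side
        ; other-next = complete (λ m _ → ⊥-elim (m refl)) (λ _ _ → trans e₂ (sym σt-side))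
            (λ _ _ → trans e₃ (sym e₂)) (λ _ n → ⊥-elim (n refl)) }

    alternating² : ∀ R → Alternating R → ∀ d → vert G d ≡ v → sideOf (next R (next R d)) ≡ sideOf d
    alternating² R alt d at = trans (alt _ (trans (local R d) at))
      (trans (cong not (alt d at)) (Bool.not-involutive (sideOf d)))

    -- In an alternating rotation the dart two places after `d` is on the side of `d`, so one
    -- exception suffices.
    nonalternating : Linked → ∀ R d → vert G d ≡ v → sideOf (next R (next R d)) ≡ not (sideOf d) → Contiguous R
    nonalternating l R d at p with classify R l
    ... | inj₁ c   = c
    ... | inj₂ alt = ⊥-elim (Bool.not-¬ {sideOf d} refl (trans (sym (alternating² R alt d at)) p))

    Arranged : ℕ → Set
    Arranged F = ∃ λ R → Contiguous R × ∃ λ F′ → F′ ≼ F × HasOrbits (facePerm G R) F′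

    -- Both darts that `improve` may put two places after `a` are on the side opposite to `a`.
    detach : Linked → ∀ R {F} → Alternating R → HasOrbits (facePerm G R) F →
      ∀ {a c} f → next R a ≡ c → vert G a ≡ v → vert G (flip G a) ≢ v → vert G (flip G c) ≢ v →
      vert G f ≡ vert G (flip G a) → vert G (flip G f) ≡ vert G (flip G c) → Arranged F
    detach l R alt h {a} f refl at a-far c-far f-at f-to = conclude (improve f f-at f-to a-far c-far)
      where
      σ : Dart G → Dart G
      σ = next R
      open FourDarts deg≡4 R a at
      ≢₁ : a ≢ σ a
      ≢₁ p = no-return 0 (s≤s (s≤s z≤n)) (sym p)
      ≢₂ : a ≢ σ (σ a)
      ≢₂ p = no-return 1 (s≤s (s≤s (s≤s z≤n))) (sym p)
      ≢₃ : a ≢ σ (σ (σ a))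
      ≢₃ p = no-return 2 (n<1+n 3) (sym p)
      open Improve {v = v} R h {a} at refl refl refl closes
        ≢₁ ≢₂ ≢₃ (≢₁ ∘ next-injective R) (≢₂ ∘ next-injective R) (≢₁ ∘ next-injective R ∘ next-injective R)
      conclude : Improved → Arranged _
      conclude (R′ , F′ , le , h′ , inj₁ p) = R′ , nonalternating l R′ a at (trans (cong sideOf p) (alt a at)) , F′ , le , h′
      conclude (R′ , F′ , le , h′ , inj₂ p) = R′ , nonalternating l R′ a at (trans (cong sideOf p)
        (trans (alternating² R alt (σ a) (trans (local R a) at)) (alt a at))) , F′ , le , h′

    arrange : Linked → ∀ R {F} → HasOrbits (facePerm G R) F → Arranged F
    arrange l R {F} h = cases (classify R l)
      where
      open Linked l
      σ : Dart G → Dart G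
      σ = next R
      p≉q : sideOf p ≢ sideOf q
      p≉q e with trans (sym p-side) (trans e q-side)
      ... | ()
      module _ (alt : Alternating R) where
        σσ : ∀ {d} → vert G d ≡ v → sideOf (σ (σ d)) ≡ sideOf d
        σσ = alternating² R alt _
        exchanged : (∃ λ R′ → HasOrbits (facePerm G R′) F × next R′ (next R′ p) ≡ σ (σ q)) → Arranged F
        exchanged (R′ , h′ , e) = R′ , nonalternating l R′ p p-at
          (trans (cong sideOf e) (trans (σσ q-at) (trans q-side (cong not (sym p-side))))) , F , (0 , refl) , h′
        swapped : (q ≡ flip G p ⊎ (vert G (flip G p) ≢ vert G p × vert G (flip G p) ≡ vert G (flip G q))) → Arranged F
        swapped s = exchanged (parallel-swap R p q (trans p-at (sym q-at)) s
          (λ e → p≉q (trans (cong sideOf (sym e)) (σσ q-at)))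
          (FourDarts.no-return deg≡4 R q q-at 1 (s≤s (s≤s (s≤s z≤n)))) h)
        along : Link p q → Arranged F
        along (loop e)         = swapped (inj₁ e)
        along (parallel far e) = swapped (inj₂ ((λ r → far (trans r p-at)) , e))
        along (via p-far q-far f f-at f-to) =
          -- The sides rule out that `q` is `p` or two places after it. So `q` directly follows `p`,
          -- or `p` follows `q` and `f` is read backwards.
          complete {P = λ d → d ≡ q → Arranged F}
            (λ e → ⊥-elim (p≉q (cong sideOf e)))
            (λ e → detach l R alt h f e p-at p-far q-far f-at f-to)
            (λ e → ⊥-elim (p≉q (trans (sym (σσ p-at)) (cong sideOf e))))
            (λ e → detach l R alt h (flip G f) (trans (cong σ (sym e)) closes) q-at q-far p-far f-to
                     (trans (cong (vert G) (flip-flip {G} f)) f-at))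
            q q-at refl
          where open FourDarts deg≡4 R p p-at using (closes; complete)
      cases : Contiguous R ⊎ Alternating R → Arranged F
      cases (inj₁ c)   = R , c , F , (0 , refl) , h
      cases (inj₂ alt) = along alt link

  -- The loss of `2 * j` faces in `arrange` raises the genus by `j`; the insertion adds one vertex
  -- and one edge and keeps the faces.
  lift-genus : Linked → ∀ R g → EmbGenus G R g → ∃ λ j → ∃ λ R* → EmbGenus G* R* (g + j)
  lift-genus l R g (F , h , euler) with arrange l R h
  ... | R′ , c , F′ , (j , F≡) , h′ =
    j , inserted , F′ , inserted-faces h′ , cong suc (euler-drop {V G} {F = F} {g = g} {j = j} euler F≡)
    where open Insert R′ c

-- The dart `d` lies on some face, so there is at least one, and Euler's formula bounds `g + g` by
-- the Betti number.
genus-bound : (G : Graph) → Dart G → ∀ R g → EmbGenus G R g → g ≤ ⌊ betti G /2⌋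
genus-bound G d R g (zero , (c , _) , _) with c d
... | ()
genus-bound G d R g (suc F , _ , euler) = ≤-trans (≤-reflexive (n≡⌊n+n/2⌋ g))
  (⌊n/2⌋-mono (m+n≤o⇒m≤o∸n (g + g) (≤-trans (m≤m+n (g + g + V G) F) (≤-reflexive total))))
  where
  open +-*-Solver
  total : g + g + V G + F ≡ E G + 1
  total = suc-injective (trans
    (solve 3 (λ g v f → con 1 :+ (g :+ g :+ v :+ f) := v :+ (con 1 :+ f) :+ con 2 :* g) refl g (V G) F)
    (trans euler (solve 1 (λ e → e :+ con 2 := con 1 :+ (e :+ con 1)) refl (E G))))

theorem2p2 : (G : Graph) → Connected G → (∀ (u : Fin (V G)) → 3 ≤ deg G u) →
    (v : Fin (V G)) → deg G v ≡ 4 →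
    (side : Fin (E G) → Bool → Bool) → SplitEdgeNotCut G v side →
    UpperEmbeddable G ⇔ UpperEmbeddable (split G v side)
theorem2p2 G _ _ v deg≡4 side notCut = mk⇔ to from
  where
  open Splitting G v side using (G*; old)
  l : ShortCycle.Linked G v side
  l = ShortCycle.shortCycle G v side notCut
  d : Dart G
  d = ShortCycle.Linked.p l
  -- `betti G*` reduces to `betti G`, as both counts grow by one.
  bound* : ∀ R g → EmbGenus G* R g → g ≤ ⌊ betti G /2⌋
  bound* = genus-bound G* (old d)
  -- A positive `j` would exceed the bound, so the lifted embedding has exactly the required genus.
  attained : (∃ λ j → ∃ λ R* → EmbGenus G* R* (⌊ betti G /2⌋ + j)) → ∃ λ R* → EmbGenus G* R* ⌊ betti G /2⌋
  attained (j , R* , emb) = R* , subst (EmbGenus G* R*)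
    (trans (cong (⌊ betti G /2⌋ +_) j≡0) (+-identityʳ _)) emb
    where
    j≡0 : j ≡ 0
    j≡0 = n≤0⇒n≡0 (+-cancelˡ-≤ ⌊ betti G /2⌋ j 0
      (≤-trans (bound* R* _ emb) (≤-reflexive (sym (+-identityʳ _)))))
  to : UpperEmbeddable G → UpperEmbeddable G*
  to ((R , emb) , _) = attained (lift-genus G v deg≡4 side l R ⌊ betti G /2⌋ emb) , bound*
  from : UpperEmbeddable G* → UpperEmbeddable G
  from ((R* , emb*) , _) = ShortCycle.contract-genus G v side l R* ⌊ betti G /2⌋ emb* , genus-bound G d
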